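{- Let $B$ be a graph and $\Psi=\{[\psi^1_{/B}],\dots,[\psi^m_{/B}]\}$ a finite set of isomorphism classes of $B$-graphs such that $\Psi^+_{<s}$ is finite for all $s\in\mathbb N$ and each $\psi^i$ is pruned. Then for each $[\psi_{/B}]\in\Psi^+$ there is a rational number $\mu[\psi_{/B}]$ such that for every $r\in\mathbb N$ the function $$I_r(\Psi,G_{/B})=\sum_{[\psi_{/B}]\in\Psi^+_{<r}}\#\bigl([\psi_{/B}]\cap G\bigr)\,\mu[\psi_{/B}]$$ (defined on $B$-graphs $G_{/B}$) satisfies: (1) $I_r(\Psi,G_{/B})=\mathbf 1_{\mathrm{Meets}(\Psi)}(G_{/B})$ whenever $\mathrm{ord}_\Psi(G_{/B})<r$; and (2) there are a constant $C\in\mathbb R$ and $s\in\mathbb N$ such that whenever $\mathrm{ord}_\Psi(G_{/B})\ge r$, $$\bigl|I_r(\Psi,G_{/B})\bigr|\le C\sum_{[\psi_{/B}]\in\Psi^+_{<r+s}\setminus\Psi^+_{<r}}\#\bigl([\psi_{/B}]\cap G\bigr).$$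
   Context: All graphs are finite. A graph $G$ consists of finite sets $V_G,E^{\mathrm{dir}}_G$, maps $h_G,t_G\colon E^{\mathrm{dir}}_G\to V_G$ and an involution $\iota_G$ with $t_G\iota_G=h_G$; its edges $E_G$ are the $\iota_G$-orbits; the degree of $v$ is $\#\{e:t_Ge=v\}$; $G$ is pruned if every vertex has degree $\ge2$; $\mathrm{ord}(G)=\#E_G-\#V_G$. A $B$-graph is a graph with a morphism (compatible with heads, tails, involutions) to $B$; $[\psi_{/B}]$ denotes its isomorphism class as a $B$-graph, and $\#([\psi_{/B}]\cap G)$ is the number of $B$-subgraphs of $G_{/B}$ isomorphic to $\psi_{/B}$. $\Psi^+$ is the set of classes $[\psi_{/B}]$ such that $\psi_{/B}$ is a union of one or more $B$-subgraphs each isomorphic to some $\psi^i_{/B}$; $\Psi^+_{<r}$ consists of those with $\mathrm{ord}(\psi)<r$. $\Psi^+\cap G_{/B}$ is the union of all $B$-subgraphs of $G_{/B}$ lying in a class of $\Psi$, and $\mathrm{ord}_\Psi(G_{/B})=\mathrm{ord}(\Psi^+\cap G_{/B})$. $\mathrm{Meets}(\Psi)$ is the class of $B$-graphs having a nonempty $B$-subgraph lying in some class of $\Psi$. -}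

module Defs where

open import Data.Nat as ℕ using (ℕ; zero; suc)
open import Data.Integer as ℤ using (ℤ; +_)
open import Data.Rational as ℚ using (ℚ)
open import Data.Fin as Fin using (Fin)
open import Data.Fin.Properties as FinP using (all?; any?)
open import Data.Bool using (Bool)
open import Data.Nat.ListAction using (sum)
open import Data.Vec as Vec using (Vec; tabulate)
import Data.Vec.Properties as VecP
open import Data.List as List using (List; []; _∷_; allFin; filter; length; deduplicate; cartesianProduct; concatMap)
open import Data.List.Membership.Propositional using (_∈_)
open import Data.List.Relation.Unary.AllPairs using (AllPairs)
open import Data.List.Relation.Unary.Any as AnyP using (Any)
open import Data.Product using (Σ; ∃; ∃-syntax; _×_; _,_; proj₁; proj₂)
import Data.Product.Properties as ProdP
open import Relation.Nullary using (¬_; Dec; does)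
open import Relation.Nullary.Decidable using (_×-dec_; _→-dec_)
open import Relation.Binary.PropositionalEquality using (_≡_)

record Graph : Set where
  field
    nV  : ℕ
    nD  : ℕ
    hd  : Fin nD → Fin nV
    tl  : Fin nD → Fin nV
    inv : Fin nD → Fin nD
    inv-invol : ∀ e → inv (inv e) ≡ e
    tl-inv    : ∀ e → tl (inv e) ≡ hd e
open Graph public

IsHom : (G H : Graph) → (Fin (nV G) → Fin (nV H)) → (Fin (nD G) → Fin (nD H)) → Set
IsHom G H fV fD =
  (∀ e → hd H (fD e) ≡ fV (hd G e)) ×
  (∀ e → tl H (fD e) ≡ fV (tl G e)) ×
  (∀ e → inv H (fD e) ≡ fD (inv G e))

record Hom (G H : Graph) : Set where
  field
    mapV  : Fin (nV G) → Fin (nV H)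
    mapD  : Fin (nD G) → Fin (nD H)
    isHom : IsHom G H mapV mapD
open Hom public

record BGraph (B : Graph) : Set where
  field
    gr : Graph
    π  : Hom gr B
open BGraph public

count : ∀ {n p} {P : Fin n → Set p} → (∀ x → Dec (P x)) → ℕ
count {n} P? = length (filter P? (allFin n))

degree : (G : Graph) → Fin (nV G) → ℕ
degree G v = count (λ e → tl G e Fin.≟ v)

Pruned : Graph → Set
Pruned G = ∀ v → 2 ℕ.≤ degree G v

-- each ι-orbit {e, ι e} is counted once, via its representative e ≤ ι e
#E : Graph → ℕ
#E G = count (λ e → e FinP.≤? inv G e)

ord : Graph → ℤ
ord G = + #E G ℤ.- + nV G

IsBHom : ∀ {B} (ψ G : BGraph B) → (Fin (nV (gr ψ)) → Fin (nV (gr G))) → (Fin (nD (gr ψ)) → Fin (nD (gr G))) → Set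
IsBHom ψ G fV fD =
  IsHom (gr ψ) (gr G) fV fD ×
  (∀ v → mapV (π G) (fV v) ≡ mapV (π ψ) v) ×
  (∀ e → mapD (π G) (fD e) ≡ mapD (π ψ) e)

Inj : ∀ {a b} → (Fin a → Fin b) → Set
Inj f = ∀ x y → f x ≡ f y → x ≡ y

Surj : ∀ {a b} → (Fin a → Fin b) → Set
Surj {a} {b} f = ∀ y → ∃[ x ] f x ≡ y

IsBEmb : ∀ {B} (ψ G : BGraph B) → (Fin (nV (gr ψ)) → Fin (nV (gr G))) → (Fin (nD (gr ψ)) → Fin (nD (gr G))) → Set
IsBEmb ψ G fV fD = IsBHom ψ G fV fD × Inj fV × Inj fD

BIso : ∀ {B} → BGraph B → BGraph B → Set
BIso ψ G = Σ (Fin (nV (gr ψ)) → Fin (nV (gr G))) λ fV → Σ (Fin (nD (gr ψ)) → Fin (nD (gr G))) λ fD →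
  IsBEmb ψ G fV fD × Surj fV × Surj fD

allFuns : (a b : ℕ) → List (Fin a → Fin b)
allFuns zero    b = (λ ()) ∷ []
allFuns (suc a) b = concatMap (λ f → List.map (λ y → cons y f) (allFin b)) (allFuns a b)
  where
  cons : Fin b → (Fin a → Fin b) → Fin (suc a) → Fin b
  cons y f Fin.zero    = y
  cons y f (Fin.suc i) = f i

private
  ∀? : ∀ {n p} {P : Fin n → Set p} → (∀ x → Dec (P x)) → Dec (∀ x → P x)
  ∀? = all?

inj? : ∀ {a b} (f : Fin a → Fin b) → Dec (Inj f)
inj? f = ∀? λ x → ∀? λ y → (f x Fin.≟ f y) →-dec (x Fin.≟ y)

isBEmb? : ∀ {B} (ψ G : BGraph B) → ∀ fV fD → Dec (IsBEmb ψ G fV fD)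
isBEmb? {B} ψ G fV fD =
  (((∀? λ e → hd (gr G) (fD e) Fin.≟ fV (hd (gr ψ) e)) ×-dec
    (∀? λ e → tl (gr G) (fD e) Fin.≟ fV (tl (gr ψ) e)) ×-dec
    (∀? λ e → inv (gr G) (fD e) Fin.≟ fD (inv (gr ψ) e))) ×-dec
   (∀? λ v → mapV (π G) (fV v) Fin.≟ mapV (π ψ) v) ×-dec
   (∀? λ e → mapD (π G) (fD e) Fin.≟ mapD (π ψ) e)) ×-dec
  inj? fV ×-dec inj? fD

Emb : ∀ {B} → BGraph B → BGraph B → Set
Emb ψ G = (Fin (nV (gr ψ)) → Fin (nV (gr G))) × (Fin (nD (gr ψ)) → Fin (nD (gr G)))

embeddings : ∀ {B} (ψ G : BGraph B) → List (Emb ψ G)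
embeddings ψ G =
  filter (λ f → isBEmb? ψ G (proj₁ f) (proj₂ f))
         (cartesianProduct (allFuns (nV (gr ψ)) (nV (gr G))) (allFuns (nD (gr ψ)) (nD (gr G))))

SubG : ∀ {B} → BGraph B → Set
SubG G = Vec Bool (nV (gr G)) × Vec Bool (nD (gr G))

-- The image of an embedding: a B-subgraph of G isomorphic to ψ.
-- Every B-subgraph of G isomorphic to ψ arises this way.
image : ∀ {B} {ψ G : BGraph B} → Emb ψ G → SubG G
image (fV , fD) = tabulate (λ v → does (any? (λ x → fV x Fin.≟ v))) ,
                  tabulate (λ e → does (any? (λ x → fD x Fin.≟ e)))

#sub : ∀ {B} → BGraph B → BGraph B → ℕ
#sub ψ G = length (deduplicate (ProdP.≡-dec (VecP.≡-dec Data.Bool._≟_) (VecP.≡-dec Data.Bool._≟_))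
                               (List.map (image {ψ = ψ} {G = G}) (embeddings ψ G)))
  where import Data.Bool

module _ {B : Graph} {m : ℕ} (Ψ : Fin m → BGraph B) where

  InUnionV : (G : BGraph B) → Fin (nV (gr G)) → Set
  InUnionV G v = ∃[ i ] Any (λ f → ∃[ x ] proj₁ f x ≡ v) (embeddings (Ψ i) G)

  InUnionD : (G : BGraph B) → Fin (nD (gr G)) → Set
  InUnionD G e = ∃[ i ] Any (λ f → ∃[ x ] proj₂ f x ≡ e) (embeddings (Ψ i) G)

  inUnionV? : (G : BGraph B) → ∀ v → Dec (InUnionV G v)
  inUnionV? G v = any? λ i → AnyP.any? (λ f → any? (λ x → proj₁ f x Fin.≟ v)) (embeddings (Ψ i) G)

  inUnionD? : (G : BGraph B) → ∀ e → Dec (InUnionD G e)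
  inUnionD? G e = any? λ i → AnyP.any? (λ f → any? (λ x → proj₂ f x Fin.≟ e)) (embeddings (Ψ i) G)

  -- ord_Ψ(G) = ord(Ψ⁺ ∩ G) = #edges − #vertices of the union subgraph
  ordΨ : BGraph B → ℤ
  ordΨ G = + count (λ e → inUnionD? G e ×-dec (e FinP.≤? inv (gr G) e))
           ℤ.- + count (inUnionV? G)

  -- [ψ] ∈ Ψ⁺ : ψ is the union of one or more B-subgraphs each isomorphic to some ψ^i
  InPlus : BGraph B → Set
  InPlus ψ = (∃[ i ] Σ (Emb (Ψ i) ψ) λ f → IsBEmb (Ψ i) ψ (proj₁ f) (proj₂ f)) ×
             ((∀ v → InUnionV ψ v) × (∀ e → InUnionD ψ e))

  Meets : BGraph B → Set
  Meets G = ∃[ i ] (0 ℕ.< nV (gr (Ψ i)) × Σ (Emb (Ψ i) G) λ f → IsBEmb (Ψ i) G (proj₁ f) (proj₂ f))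

  Reps : ℕ → List (BGraph B) → Set
  Reps s L =
    (∀ {ψ} → ψ ∈ L → InPlus ψ × ord (gr ψ) ℤ.< + s) ×
    (∀ ψ → InPlus ψ → ord (gr ψ) ℤ.< + s → ∃[ φ ] (φ ∈ L × BIso ψ φ)) ×
    AllPairs (λ φ φ' → ¬ BIso φ φ') L

ℕtoℚ : ℕ → ℚ
ℕtoℚ n = + n ℚ./ 1

-- I_r(Ψ, G) computed from a system of representatives L of Ψ⁺_{<r}
Isum : ∀ {B} → (BGraph B → ℚ) → List (BGraph B) → BGraph B → ℚ
Isum μ L G = List.foldr (λ ψ acc → ℕtoℚ (#sub ψ G) ℚ.* μ ψ ℚ.+ acc) ℚ.0ℚ L

tailSum : ∀ {B} → ℕ → List (BGraph B) → BGraph B → ℕ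
tailSum r L G = sum (List.map (λ ψ → #sub ψ G) (filter (λ ψ → + r ℤ.≤? ord (gr ψ)) L))

{-# OPTIONS --safe #-}
module Submission where

-- Call a Ψ-piece of G a copy in G of some nonempty ψ^i.  Inclusion–exclusion over the families
-- of pieces gives 1_Meets(G) = Σ_H μ(H), where μ(H) = Σ (-1)^(|F| + 1) over the nonempty families F
-- of pieces with union H; this depends only on the isomorphism class of H and is supported on Ψ⁺.
-- For (1): since each ψ^i is pruned, a vertex of Ψ⁺ ∩ G outside H is the tail of at least two
-- oriented edges outside H, so ord H ≤ ord_Ψ(G), and the truncation at r drops nothing.
-- For (2): adding to H ⊆ G with ord H < r the copies of the ψ^i in G one at a time ends at
-- ord_Ψ(G) ≥ r and raises the order by at most s = Σ_i #D(ψ^i) per step, so H lies in some H′ in Ψ⁺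
-- with r ≤ ord H′ < r + s.  Only boundedly many H lie in a given H′, and μ is bounded on Ψ⁺_{<r}.

-- `μ` has to be intrinsic to ψ, whereas inclusion-exclusion runs over the pieces of G. The bridge:
-- a family with union H uses only pieces contained in H, and these are the pieces of H as a graph
-- in its own right. So the coefficient of H inside G is `μ` of the abstract graph (`weight-push`),
-- and I_r becomes a plain sum over subgraphs of G.
--
-- Pieces are listed once per embedding, hence with repetitions. This is harmless: families that
-- differ only in a redundant piece cancel in pairs, so the signed sum sees only the set of pieces
-- (`cov-set`). An empty ψ^i is no piece, since `Meets` asks for a nonempty subgraph; it still puts
-- the empty graph into Ψ⁺, where `μ` vanishes.
--
-- In (2) the constant is chosen before the lists of representatives are given. It is computed from
-- the lists that the finiteness hypothesis supplies and carried over to all others by isomorphism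
-- invariance.

open import Defs
open import Data.Nat as ℕ using (ℕ; zero; suc; _+_; s≤s; z≤n)
import Data.Nat.Properties as ℕP
open import Data.Nat.ListAction using (sum)
open import Data.Integer as ℤ using (ℤ; +_) renaming (_<_ to _<ℤ_; _≤_ to _≤ℤ_)
import Data.Integer.Properties as ℤP
import Data.Integer.Solver as ℤSolver
open import Data.Rational as ℚ using (ℚ; ∣_∣; _≤_; _*_; 0ℚ; 1ℚ)
import Data.Rational.Properties as ℚP
import Data.Rational.Solver as ℚSolver
import Data.Rational.Unnormalised as ℚᵘ
import Data.Rational.Unnormalised.Properties as ℚᵘP
import Data.Bool as Bool
open import Data.Bool using (true; false)
open import Data.Fin as Fin using (Fin)
import Data.Fin.Properties as FinP
open import Data.Fin.Properties using (any?)
open import Data.Fin.Subset using (Subset; _∪_; _⊆_; inside; outside)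
  renaming (_∈_ to _∈ₛ_; _∉_ to _∉ₛ_; ⊥ to ∅; ⊤ to full)
import Data.Fin.Subset.Properties as SubsetP
open import Data.Fin.Subset.Properties using (_∈?_; ⊆-antisym; x∈p∪q⁺; x∈p∪q⁻; ∉⊥; ∈⊤)
open import Data.Vec as Vec using (tabulate; []; _∷_)
import Data.Vec.Properties as VecP
open import Data.List as List using (List; []; _∷_; _++_; map; foldr; filter; length; allFin; concatMap; deduplicate)
import Data.List.Properties as ListP
open import Data.List.Membership.Propositional using (_∈_; _∉_; find; lose)
open import Data.List.Membership.Propositional.Properties
open import Data.List.Membership.Propositional.Properties.WithK using (unique∧set⇒bag)
open import Data.List.Relation.Binary.BagAndSetEquality using (∼bag⇒↭)
open import Data.List.Relation.Binary.Permutation.Propositional as Perm using (_↭_)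
open import Data.List.Relation.Binary.Permutation.Propositional.Properties using (++-comm)
open import Data.List.Relation.Unary.All as All using (All; []; _∷_)
open import Data.List.Relation.Unary.AllPairs using (AllPairs; []; _∷_)
open import Data.List.Relation.Unary.Any as Any using (Any; here; there)
open import Data.List.Relation.Unary.Unique.DecPropositional.Properties using (deduplicate-!)
open import Data.List.Relation.Unary.Unique.Propositional using (Unique)
import Data.List.Relation.Unary.Unique.Propositional.Properties as Uniq
open import Data.Product using (Σ; ∃-syntax; _×_; _,_; proj₁; proj₂)
import Data.Product.Properties as ProdP
open import Data.Sum using (_⊎_; inj₁; inj₂; [_,_]′)
open import Data.Empty using (⊥)
open import Function using (_∘_; id; mk⇔)
open import Relation.Nullary using (¬_; Dec; yes; no; does; contradiction)
open import Relation.Nullary.Decidable using (_×-dec_; ¬?; dec-true)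
open import Relation.Binary.PropositionalEquality
  using (_≡_; _≢_; refl; sym; trans; cong; cong₂; subst; subst₂; module ≡-Reasoning)
open import Relation.Binary.Definitions using (DecidableEquality)
open import Algebra.Definitions using (Associative; Commutative; Idempotent)

-- Finite lists, sums and counting

module _ {A : Set} where

  remove-∈ : ∀ {x : A} {ys} → x ∈ ys →
             ∃[ zs ] length ys ≡ suc (length zs) × (∀ {y} → y ∈ ys → y ≢ x → y ∈ zs)
  remove-∈ {ys = y ∷ ys} (here refl) = ys , refl , λ where
    (here y≡x) y≢x → contradiction y≡x y≢x
    (there p)  _   → p
  remove-∈ {ys = y ∷ ys} (there p) with zs , eq , keep ← remove-∈ p =
    y ∷ zs , cong suc eq , λ where
      (here e)  _   → here e
      (there q) y≢x → there (keep q y≢x)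

  length-⊆ : ∀ {xs ys : List A} → Unique xs → (∀ {x} → x ∈ xs → x ∈ ys) → length xs ℕ.≤ length ys
  length-⊆ {[]} _ _ = z≤n
  length-⊆ {x ∷ xs} (x∉ ∷ u) sub with zs , eq , keep ← remove-∈ (sub (here refl)) =
    subst (suc (length xs) ℕ.≤_) (sym eq)
      (s≤s (length-⊆ u λ p → keep (sub (there p)) (λ e → All.lookup x∉ p (sym e))))

  -- Counting by fibres: the lists of the single fibres are concatenated. An `x` related to several
  -- `y` is listed several times, which only weakens the bound.
  length-cover : ∀ {B : Set} {R : A → B → Set} {N} (ys : List B) →
    (∀ {y} → y ∈ ys → ∃[ zs ] length zs ℕ.≤ N × (∀ {x} → R x y → x ∈ zs)) →
    ∃[ zs ] length zs ℕ.≤ N ℕ.* length ys × (∀ {x y} → y ∈ ys → R x y → x ∈ zs)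
  length-cover [] _ = [] , z≤n , λ ()
  length-cover {N = N} (y ∷ ys) fibre
    with zs , len , cov ← fibre (here refl) | zs′ , len′ , cov′ ← length-cover ys (fibre ∘ there) =
    zs ++ zs′ ,
    ℕP.≤-trans (ℕP.≤-reflexive (ListP.length-++ zs))
      (ℕP.≤-trans (ℕP.+-mono-≤ len len′) (ℕP.≤-reflexive (sym (ℕP.*-suc N (length ys))))) ,
    λ where
      (here refl) r → ∈-++⁺ˡ (cov r)
      (there p)   r → ∈-++⁺ʳ zs (cov′ p r)

  ∈-sum : ∀ (f : A → ℕ) {x xs} → x ∈ xs → f x ℕ.≤ sum (map f xs)
  ∈-sum f (here refl) = ℕP.m≤m+n _ _
  ∈-sum f (there p)   = ℕP.≤-trans (∈-sum f p) (ℕP.m≤n+m _ _)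

  concatMap-unique : ∀ {B : Set} {_≉_ : A → A → Set} (f : A → List B) →
    (∀ x → Unique (f x)) → (∀ {x y z} → x ≉ y → z ∈ f x → z ∈ f y → ⊥) →
    ∀ {xs} → AllPairs _≉_ xs → Unique (concatMap f xs)
  concatMap-unique f uf dj [] = []
  concatMap-unique {_≉_ = _≉_} f uf dj {x ∷ xs} (x≉ ∷ ap) =
    Uniq.++⁺ (uf x) (concatMap-unique f uf dj ap) λ (p , q) → go x≉ (∈-concatMap⁻ f q) p
    where
    go : ∀ {ys z} → All (x ≉_) ys → Any (λ y → z ∈ f y) ys → z ∈ f x → ⊥
    go (n ∷ _) (here q)  p = dj n p q
    go (_ ∷ a) (there q) p = go a q p

  length-concatMap : ∀ {B : Set} (f : A → List B) xs → length (concatMap f xs) ≡ sum (map (length ∘ f) xs)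
  length-concatMap f []       = refl
  length-concatMap f (x ∷ xs) = trans (ListP.length-++ (f x)) (cong (λ n → length (f x) + n) (length-concatMap f xs))

sumℚ : ∀ {A : Set} → (A → ℚ) → List A → ℚ
sumℚ f = foldr (λ x acc → f x ℚ.+ acc) 0ℚ

sumℚ-++ : ∀ {A : Set} (f : A → ℚ) xs ys → sumℚ f (xs ++ ys) ≡ sumℚ f xs ℚ.+ sumℚ f ys
sumℚ-++ f []       ys = sym (ℚP.+-identityˡ _)
sumℚ-++ f (x ∷ xs) ys = trans (cong (f x ℚ.+_) (sumℚ-++ f xs ys)) (sym (ℚP.+-assoc (f x) _ _))

sumℚ-concatMap : ∀ {A B : Set} (f : B → ℚ) (g : A → List B) xs →
  sumℚ f (concatMap g xs) ≡ sumℚ (λ x → sumℚ f (g x)) xs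
sumℚ-concatMap f g []       = refl
sumℚ-concatMap f g (x ∷ xs) = trans (sumℚ-++ f (g x) _) (cong (sumℚ f (g x) ℚ.+_) (sumℚ-concatMap f g xs))

module _ {A : Set} where

  sumℚ-cong : ∀ {f g : A → ℚ} xs → (∀ {x} → x ∈ xs → f x ≡ g x) → sumℚ f xs ≡ sumℚ g xs
  sumℚ-cong []       _  = refl
  sumℚ-cong (x ∷ xs) eq = cong₂ ℚ._+_ (eq (here refl)) (sumℚ-cong xs (eq ∘ there))

  sumℚ-zero : ∀ {f : A → ℚ} xs → (∀ {x} → x ∈ xs → f x ≡ 0ℚ) → sumℚ f xs ≡ 0ℚ
  sumℚ-zero []       _  = refl
  sumℚ-zero (x ∷ xs) eq = cong₂ ℚ._+_ (eq (here refl)) (sumℚ-zero xs (eq ∘ there))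

  sumℚ-minus : ∀ (f g : A → ℚ) xs → sumℚ (λ x → f x ℚ.- g x) xs ≡ sumℚ f xs ℚ.- sumℚ g xs
  sumℚ-minus f g []       = refl
  sumℚ-minus f g (x ∷ xs) = begin
    (f x ℚ.- g x) ℚ.+ sumℚ (λ y → f y ℚ.- g y) xs   ≡⟨ cong ((f x ℚ.- g x) ℚ.+_) (sumℚ-minus f g xs) ⟩
    (f x ℚ.- g x) ℚ.+ (F ℚ.- G)                      ≡⟨ ℚP.+-assoc (f x) _ _ ⟩
    f x ℚ.+ (ℚ.- g x ℚ.+ (F ℚ.- G))                  ≡⟨ cong (f x ℚ.+_) (sym (ℚP.+-assoc (ℚ.- g x) F _)) ⟩
    f x ℚ.+ ((ℚ.- g x ℚ.+ F) ℚ.- G)                  ≡⟨ cong (λ z → f x ℚ.+ (z ℚ.- G)) (ℚP.+-comm (ℚ.- g x) F) ⟩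
    f x ℚ.+ ((F ℚ.- g x) ℚ.- G)                      ≡⟨ cong (f x ℚ.+_) (ℚP.+-assoc F _ _) ⟩
    f x ℚ.+ (F ℚ.+ (ℚ.- g x ℚ.- G))                  ≡⟨ sym (ℚP.+-assoc (f x) F _) ⟩
    (f x ℚ.+ F) ℚ.+ (ℚ.- g x ℚ.- G)                  ≡⟨ cong ((f x ℚ.+ F) ℚ.+_) (sym (ℚP.neg-distrib-+ (g x) G)) ⟩
    (f x ℚ.+ F) ℚ.- (g x ℚ.+ G)                      ∎
    where
    open ≡-Reasoning
    F G : ℚ
    F = sumℚ f xs
    G = sumℚ g xs

  sumℚ-↭ : ∀ (f : A → ℚ) {xs ys} → xs ↭ ys → sumℚ f xs ≡ sumℚ f ys
  sumℚ-↭ f Perm.refl          = refl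
  sumℚ-↭ f (Perm.prep x p)    = cong (f x ℚ.+_) (sumℚ-↭ f p)
  sumℚ-↭ f (Perm.swap {xs} {ys} x y p)  = begin
    f x ℚ.+ (f y ℚ.+ sumℚ f xs)   ≡⟨ sym (ℚP.+-assoc (f x) _ _) ⟩
    (f x ℚ.+ f y) ℚ.+ sumℚ f xs   ≡⟨ cong₂ ℚ._+_ (ℚP.+-comm (f x) (f y)) (sumℚ-↭ f p) ⟩
    (f y ℚ.+ f x) ℚ.+ sumℚ f ys   ≡⟨ ℚP.+-assoc (f y) _ _ ⟩
    f y ℚ.+ (f x ℚ.+ sumℚ f ys)   ∎
    where open ≡-Reasoning
  sumℚ-↭ f (Perm.trans p q)   = trans (sumℚ-↭ f p) (sumℚ-↭ f q)

  sumℚ-filter : ∀ (f : A → ℚ) {P : A → Set} (P? : ∀ x → Dec (P x)) ys →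
    (∀ {y} → y ∈ ys → ¬ P y → f y ≡ 0ℚ) → sumℚ f (filter P? ys) ≡ sumℚ f ys
  sumℚ-filter f P? []       _  = refl
  sumℚ-filter f P? (y ∷ ys) h0 with P? y
  ... | yes _ = cong (f y ℚ.+_) (sumℚ-filter f P? ys (h0 ∘ there))
  ... | no ¬p = trans (sumℚ-filter f P? ys (h0 ∘ there))
                  (sym (trans (cong (ℚ._+ sumℚ f ys) (h0 (here refl) ¬p)) (ℚP.+-identityˡ _)))

  -- Duplicate-free lists with the same members are permutations of each other; this is applied to
  -- `xs` and the part of `ys` inside `xs`.
  sumℚ-extend : DecidableEquality A → ∀ (f : A → ℚ) {xs ys} → Unique xs → Unique ys →
    (∀ {x} → x ∈ xs → x ∈ ys) → (∀ {y} → y ∈ ys → y ∉ xs → f y ≡ 0ℚ) → sumℚ f xs ≡ sumℚ f ys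
  sumℚ-extend _≟_ f {xs} {ys} ux uy sub h0 = trans
    (sumℚ-↭ f (∼bag⇒↭ (unique∧set⇒bag ux (Uniq.filter⁺ (_∈ₗ? xs) uy)
      (mk⇔ (λ p → ∈-filter⁺ (_∈ₗ? xs) (sub p) p) (λ q → proj₂ (∈-filter⁻ (_∈ₗ? xs) {xs = ys} q))))))
    (sumℚ-filter f (_∈ₗ? xs) ys h0)
    where open import Data.List.Membership.DecPropositional _≟_ using () renaming (_∈?_ to _∈ₗ?_)

-- `ℕtoℚ` normalises a fraction, so the law is checked on unnormalised fractions with denominator 1.
ℕtoℚ-+ : ∀ a b → ℕtoℚ (a + b) ≡ ℕtoℚ a ℚ.+ ℕtoℚ b
ℕtoℚ-+ a b = ℚP.toℚᵘ-injective (begin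
  ℚ.toℚᵘ (ℕtoℚ (a + b))                       ≈⟨ ℚP.toℚᵘ-fromℚᵘ (ℚᵘ.mkℚᵘ (ℤ.+ (a + b)) 0) ⟩
  ℚᵘ.mkℚᵘ (ℤ.+ (a + b)) 0                      ≈⟨ ℚᵘ.*≡* (cong (ℤ._* ℤ.+ 1)
                                                    (sym (cong₂ ℤ._+_ (ℤP.*-identityʳ (ℤ.+ a)) (ℤP.*-identityʳ (ℤ.+ b))))) ⟩
  ℚᵘ.mkℚᵘ (ℤ.+ a) 0 ℚᵘ.+ ℚᵘ.mkℚᵘ (ℤ.+ b) 0     ≈⟨ ℚᵘP.+-cong (ℚP.toℚᵘ-fromℚᵘ (ℚᵘ.mkℚᵘ (ℤ.+ a) 0)) (ℚP.toℚᵘ-fromℚᵘ (ℚᵘ.mkℚᵘ (ℤ.+ b) 0)) ⟨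
  ℚ.toℚᵘ (ℕtoℚ a) ℚᵘ.+ ℚ.toℚᵘ (ℕtoℚ b)         ≈⟨ ℚP.toℚᵘ-homo-+ (ℕtoℚ a) (ℕtoℚ b) ⟨
  ℚ.toℚᵘ (ℕtoℚ a ℚ.+ ℕtoℚ b)                   ∎)
  where open ℚᵘP.≃-Reasoning

ℕtoℚ-* : ∀ a b → ℕtoℚ (a ℕ.* b) ≡ ℕtoℚ a ℚ.* ℕtoℚ b
ℕtoℚ-* zero    b = sym (ℚP.*-zeroˡ (ℕtoℚ b))
ℕtoℚ-* (suc a) b = begin
  ℕtoℚ (b + a ℕ.* b)                     ≡⟨ ℕtoℚ-+ b (a ℕ.* b) ⟩
  ℕtoℚ b ℚ.+ ℕtoℚ (a ℕ.* b)              ≡⟨ cong₂ ℚ._+_ (sym (ℚP.*-identityˡ (ℕtoℚ b))) (ℕtoℚ-* a b) ⟩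
  1ℚ ℚ.* ℕtoℚ b ℚ.+ ℕtoℚ a ℚ.* ℕtoℚ b    ≡⟨ sym (ℚP.*-distribʳ-+ (ℕtoℚ b) 1ℚ (ℕtoℚ a)) ⟩
  (1ℚ ℚ.+ ℕtoℚ a) ℚ.* ℕtoℚ b             ≡⟨ cong (ℚ._* ℕtoℚ b) (sym (ℕtoℚ-+ 1 a)) ⟩
  ℕtoℚ (suc a) ℚ.* ℕtoℚ b                ∎
  where open ≡-Reasoning

0≤ℕtoℚ : ∀ n → 0ℚ ℚ.≤ ℕtoℚ n
0≤ℕtoℚ zero    = ℚP.≤-refl
0≤ℕtoℚ (suc n) = subst (0ℚ ℚ.≤_) (sym (ℕtoℚ-+ 1 n)) (ℚP.+-mono-≤ (ℚP.nonNegative⁻¹ 1ℚ) (0≤ℕtoℚ n))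

ℕtoℚ-mono : ∀ {a b} → a ℕ.≤ b → ℕtoℚ a ℚ.≤ ℕtoℚ b
ℕtoℚ-mono {a} {b} a≤b = subst (ℕtoℚ a ℚ.≤_)
  (trans (sym (ℕtoℚ-+ a (b ℕ.∸ a))) (cong ℕtoℚ (ℕP.m+[n∸m]≡n a≤b)))
  (subst (ℚ._≤ ℕtoℚ a ℚ.+ ℕtoℚ (b ℕ.∸ a)) (ℚP.+-identityʳ (ℕtoℚ a)) (ℚP.+-monoʳ-≤ (ℕtoℚ a) (0≤ℕtoℚ (b ℕ.∸ a))))

module _ {A : Set} where

  sumℚ-const : ∀ c (xs : List A) → sumℚ (λ _ → c) xs ≡ ℕtoℚ (length xs) ℚ.* c
  sumℚ-const c []       = sym (ℚP.*-zeroˡ c)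
  sumℚ-const c (x ∷ xs) = begin
    c ℚ.+ sumℚ (λ _ → c) xs                        ≡⟨ cong₂ ℚ._+_ (sym (ℚP.*-identityˡ c)) (sumℚ-const c xs) ⟩
    1ℚ ℚ.* c ℚ.+ ℕtoℚ (length xs) ℚ.* c            ≡⟨ sym (ℚP.*-distribʳ-+ c 1ℚ (ℕtoℚ (length xs))) ⟩
    (1ℚ ℚ.+ ℕtoℚ (length xs)) ℚ.* c                ≡⟨ cong (ℚ._* c) (sym (ℕtoℚ-+ 1 (length xs))) ⟩
    ℕtoℚ (suc (length xs)) ℚ.* c                   ∎
    where open ≡-Reasoning

  sumℚ-nonneg : ∀ {f : A → ℚ} xs → (∀ x → 0ℚ ℚ.≤ f x) → 0ℚ ℚ.≤ sumℚ f xs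
  sumℚ-nonneg []       _ = ℚP.≤-refl
  sumℚ-nonneg (x ∷ xs) h = ℚP.+-mono-≤ (h x) (sumℚ-nonneg xs h)

  ∈-sumℚ : ∀ {f : A → ℚ} {x xs} → (∀ x → 0ℚ ℚ.≤ f x) → x ∈ xs → f x ℚ.≤ sumℚ f xs
  ∈-sumℚ {f} {x} {_ ∷ xs} h (here refl) =
    subst (ℚ._≤ f x ℚ.+ sumℚ f xs) (ℚP.+-identityʳ (f x)) (ℚP.+-monoʳ-≤ (f x) (sumℚ-nonneg xs h))
  ∈-sumℚ {f} {x} {y ∷ xs} h (there p) =
    subst (ℚ._≤ f y ℚ.+ sumℚ f xs) (ℚP.+-identityˡ (f x)) (ℚP.+-mono-≤ (h y) (∈-sumℚ h p))

  ∣sumℚ∣-bound : ∀ (n : A → ℕ) (g : A → ℚ) K xs → (∀ {x} → x ∈ xs → ℚ.∣ g x ∣ ℚ.≤ K) →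
    ℚ.∣ sumℚ (λ x → ℕtoℚ (n x) ℚ.* g x) xs ∣ ℚ.≤ K ℚ.* ℕtoℚ (sum (map n xs))
  ∣sumℚ∣-bound n g K []       _ = ℚP.≤-reflexive (sym (ℚP.*-zeroʳ K))
  ∣sumℚ∣-bound n g K (x ∷ xs) h = begin
    ℚ.∣ ℕtoℚ (n x) ℚ.* g x ℚ.+ S ∣                        ≤⟨ ℚP.∣p+q∣≤∣p∣+∣q∣ (ℕtoℚ (n x) ℚ.* g x) S ⟩
    ℚ.∣ ℕtoℚ (n x) ℚ.* g x ∣ ℚ.+ ℚ.∣ S ∣                  ≡⟨ cong (ℚ._+ ℚ.∣ S ∣) (trans (ℚP.∣p*q∣≡∣p∣*∣q∣ (ℕtoℚ (n x)) (g x))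
                                                                 (cong (ℚ._* ℚ.∣ g x ∣) (ℚP.0≤p⇒∣p∣≡p (0≤ℕtoℚ (n x))))) ⟩
    ℕtoℚ (n x) ℚ.* ℚ.∣ g x ∣ ℚ.+ ℚ.∣ S ∣                  ≤⟨ ℚP.+-mono-≤
                                                                 (ℚP.*-monoˡ-≤-nonNeg (ℕtoℚ (n x)) ⦃ ℚ.nonNegative (0≤ℕtoℚ (n x)) ⦄ (h (here refl)))
                                                                 (∣sumℚ∣-bound n g K xs (h ∘ there)) ⟩
    ℕtoℚ (n x) ℚ.* K ℚ.+ K ℚ.* ℕtoℚ (sum (map n xs))      ≡⟨ cong (ℚ._+ K ℚ.* ℕtoℚ (sum (map n xs))) (ℚP.*-comm (ℕtoℚ (n x)) K) ⟩
    K ℚ.* ℕtoℚ (n x) ℚ.+ K ℚ.* ℕtoℚ (sum (map n xs))      ≡⟨ sym (ℚP.*-distribˡ-+ K (ℕtoℚ (n x)) (ℕtoℚ (sum (map n xs)))) ⟩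
    K ℚ.* (ℕtoℚ (n x) ℚ.+ ℕtoℚ (sum (map n xs)))          ≡⟨ cong (K ℚ.*_) (sym (ℕtoℚ-+ (n x) (sum (map n xs)))) ⟩
    K ℚ.* ℕtoℚ (n x + sum (map n xs))                     ∎
    where
    open ℚP.≤-Reasoning
    S : ℚ
    S = sumℚ (λ y → ℕtoℚ (n y) ℚ.* g y) xs

scale-bound : ∀ {x} K N n t → 0ℚ ℚ.≤ K → x ℚ.≤ K ℚ.* ℕtoℚ n → n ℕ.≤ N ℕ.* t → x ℚ.≤ (K ℚ.* ℕtoℚ N) ℚ.* ℕtoℚ t
scale-bound {x} K N n t 0≤K x≤ n≤ = begin
  x                                ≤⟨ x≤ ⟩
  K ℚ.* ℕtoℚ n                     ≤⟨ ℚP.*-monoˡ-≤-nonNeg K ⦃ ℚ.nonNegative 0≤K ⦄ (ℕtoℚ-mono n≤) ⟩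
  K ℚ.* ℕtoℚ (N ℕ.* t)             ≡⟨ cong (K ℚ.*_) (ℕtoℚ-* N t) ⟩
  K ℚ.* (ℕtoℚ N ℚ.* ℕtoℚ t)        ≡⟨ sym (ℚP.*-assoc K (ℕtoℚ N) (ℕtoℚ t)) ⟩
  (K ℚ.* ℕtoℚ N) ℚ.* ℕtoℚ t        ∎
  where open ℚP.≤-Reasoning

-- Comparing counts over finite types

module _ {a b : ℕ} {P : Fin a → Set} {Q : Fin b → Set} (P? : ∀ x → Dec (P x)) (Q? : ∀ x → Dec (Q x)) where

  count-inj : (f : Fin a → Fin b) → (∀ {x y} → P x → P y → f x ≡ f y → x ≡ y) → (∀ {x} → P x → Q (f x)) →
              count P? ℕ.≤ count Q?
  count-inj f inj pq = subst (ℕ._≤ _) (ListP.length-map f xs)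
    (length-⊆ (unique xs (All.tabulate λ p → proj₂ (∈-filter⁻ P? {xs = allFin a} p))
                         (Uniq.filter⁺ P? (Uniq.allFin⁺ a)))
              sub)
    where
    xs : List (Fin a)
    xs = filter P? (allFin a)
    unique : ∀ zs → All P zs → Unique zs → Unique (map f zs)
    unique []       _        _       = []
    unique (z ∷ zs) (p ∷ ps) (n ∷ u) =
      All.tabulate (λ q e → let (y , y∈ , eq) = ∈-map⁻ f q in
        All.lookup n y∈ (inj p (All.lookup ps y∈) (trans e eq))) ∷ unique zs ps u
    sub : ∀ {y} → y ∈ map f xs → y ∈ filter Q? (allFin b)
    sub q with x , x∈ , refl ← ∈-map⁻ f q = ∈-filter⁺ Q? (∈-allFin _) (pq (proj₂ (∈-filter⁻ P? {xs = allFin a} x∈)))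

  count-surj : (f : Fin a → Fin b) → (∀ {y} → Q y → ∃[ x ] P x × f x ≡ y) → count Q? ℕ.≤ count P?
  count-surj f sur = subst (count Q? ℕ.≤_) (ListP.length-map f (filter P? (allFin a)))
    (length-⊆ (Uniq.filter⁺ Q? (Uniq.allFin⁺ b)) λ q →
      let (x , p , eq) = sur (proj₂ (∈-filter⁻ Q? {xs = allFin b} q))
      in subst (_∈ _) eq (∈-map⁺ f (∈-filter⁺ P? (∈-allFin x) p)))

module _ {n : ℕ} {P Q R : Fin n → Set}
  (P? : ∀ x → Dec (P x)) (Q? : ∀ x → Dec (Q x)) (R? : ∀ x → Dec (R x)) where

  count-⊎-≤ : (∀ {x} → R x → P x ⊎ Q x) → count R? ℕ.≤ count P? + count Q?
  count-⊎-≤ split = subst (count R? ℕ.≤_) (ListP.length-++ (filter P? (allFin n)))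
    (length-⊆ (Uniq.filter⁺ R? (Uniq.allFin⁺ n)) λ r →
      [ ∈-++⁺ˡ ∘ ∈-filter⁺ P? (∈-allFin _) , ∈-++⁺ʳ _ ∘ ∈-filter⁺ Q? (∈-allFin _) ]′
        (split (proj₂ (∈-filter⁻ R? {xs = allFin n} r))))

  count-⊎-≥ : (∀ {x} → P x → Q x → ⊥) → (∀ {x} → P x ⊎ Q x → R x) → count P? + count Q? ℕ.≤ count R?
  count-⊎-≥ disj join = subst (ℕ._≤ count R?) (ListP.length-++ (filter P? (allFin n)))
    (length-⊆ (Uniq.++⁺ (Uniq.filter⁺ P? (Uniq.allFin⁺ n)) (Uniq.filter⁺ Q? (Uniq.allFin⁺ n))
                 λ (p , q) → disj (proj₂ (∈-filter⁻ P? {xs = allFin n} p)) (proj₂ (∈-filter⁻ Q? {xs = allFin n} q)))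
      λ q → ∈-filter⁺ R? (∈-allFin _) (join
        ([ inj₁ ∘ proj₂ ∘ ∈-filter⁻ P? {xs = allFin n} , inj₂ ∘ proj₂ ∘ ∈-filter⁻ Q? {xs = allFin n} ]′
          (∈-++⁻ (filter P? (allFin n)) q))))

count-cong : ∀ {n} {P Q : Fin n → Set} (P? : ∀ x → Dec (P x)) (Q? : ∀ x → Dec (Q x)) →
  (∀ {x} → P x → Q x) → (∀ {x} → Q x → P x) → count P? ≡ count Q?
count-cong P? Q? to from = ℕP.≤-antisym (count-inj P? Q? id (λ _ _ e → e) to) (count-inj Q? P? id (λ _ _ e → e) from)

-- Signed sums over covers in a semilattice

module SignedCovers {A : Set} (_∪_ : A → A → A) (_≟_ : DecidableEquality A) where

  infix 4 _≼_
  _≼_ : A → A → Set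
  x ≼ y = x ∪ y ≡ y

  δ : A → A → ℚ
  δ a M with a ≟ M
  ... | yes _ = 1ℚ
  ... | no _  = 0ℚ

  -- Σ (-1)^|S| over the sublists S of xs whose union together with a is M.
  cov : List A → A → A → ℚ
  cov []       a M = δ a M
  cov (x ∷ xs) a M = cov xs a M ℚ.- cov xs (a ∪ x) M

  -- The same sum over nonempty S with the opposite sign, i.e. Σ (-1)^(|S| + 1).
  cov⁺ : List A → A → A → ℚ
  cov⁺ xs a M = δ a M ℚ.- cov xs a M

  unions : List A → A → List A
  unions []       a = a ∷ []
  unions (x ∷ xs) a = unions xs a ++ unions xs (a ∪ x)

  unions-ind : ∀ {Q : A → Set} xs {a} → Q a → (∀ {b x} → x ∈ xs → Q b → Q (b ∪ x)) → ∀ {M} → M ∈ unions xs a → Q M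
  unions-ind []       qa step (here refl) = qa
  unions-ind {Q} (x ∷ xs) {a} qa step p with ∈-++⁻ (unions xs a) p
  ... | inj₁ q = unions-ind {Q} xs qa (step ∘ there) q
  ... | inj₂ q = unions-ind {Q} xs (step (here refl) qa) (step ∘ there) q

  a∈unions : ∀ xs {a} → a ∈ unions xs a
  a∈unions []       = here refl
  a∈unions (x ∷ xs) = ∈-++⁺ˡ (a∈unions xs)

  δ-refl : ∀ a → δ a a ≡ 1ℚ
  δ-refl a with a ≟ a
  ... | yes _ = refl
  ... | no n  = contradiction refl n

  δ-≢ : ∀ {a M} → a ≢ M → δ a M ≡ 0ℚ
  δ-≢ {a} {M} n with a ≟ M
  ... | yes e = contradiction e n
  ... | no _  = refl

  emptyIndicator : List A → ℚ
  emptyIndicator []      = 1ℚ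
  emptyIndicator (_ ∷ _) = 0ℚ

module SignedCoverLaws {A : Set} (_∪_ : A → A → A) (_≟_ : DecidableEquality A)
  (assoc : Associative _≡_ _∪_) (comm : Commutative _≡_ _∪_) (idem : Idempotent _≡_ _∪_) where

  open SignedCovers _∪_ _≟_

  ≼-trans : ∀ {x y z} → x ≼ y → y ≼ z → x ≼ z
  ≼-trans {x} {y} {z} p q = trans (cong (x ∪_) (sym q)) (trans (sym (assoc x y z)) (trans (cong (_∪ z) p) q))

  x≼x∪y : ∀ x y → x ≼ x ∪ y
  x≼x∪y x y = trans (sym (assoc x x y)) (cong (_∪ y) (idem x))

  y≼x∪y : ∀ x y → y ≼ x ∪ y
  y≼x∪y x y = subst (y ≼_) (comm y x) (x≼x∪y y x)

  -- Joins only grow, so no family starting at `a` ends at an `M` that is not above `a`.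
  cov-⋠ : ∀ xs {a M} → ¬ a ≼ M → cov xs a M ≡ 0ℚ
  cov-⋠ [] {a} {M} n with a ≟ M
  ... | yes refl = contradiction (idem a) n
  ... | no _     = refl
  cov-⋠ (x ∷ xs) {a} n = cong₂ ℚ._-_ (cov-⋠ xs n) (cov-⋠ xs (n ∘ ≼-trans (x≼x∪y a x)))

  -- Toggling `x` flips the sign of a family and keeps its union, so the families cancel in pairs.
  cov-absorb : ∀ {x xs a M} → x ∈ xs → x ≼ a → cov xs a M ≡ 0ℚ
  cov-absorb {x} {_ ∷ xs} {a} {M} (here refl) x≼a =
    trans (cong (λ b → cov xs a M ℚ.- cov xs b M) (trans (comm a x) x≼a)) (ℚP.+-inverseʳ (cov xs a M))
  cov-absorb {xs = y ∷ xs} {a} (there p) x≼a =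
    cong₂ ℚ._-_ (cov-absorb p x≼a) (cov-absorb p (≼-trans x≼a (x≼x∪y a y)))

  minus-zero : ∀ p {q} → q ≡ 0ℚ → p ℚ.- q ≡ p
  minus-zero p refl = ℚP.+-identityʳ p

  -- The families using the head start at `a ∪ x`. If `x` lies below `M`, its other occurrence in
  -- `xs` is absorbed by that start; otherwise they can no longer end at `M`.
  cov-drop : ∀ {x xs a M} → (x ≼ M → x ∈ xs) → cov (x ∷ xs) a M ≡ cov xs a M
  cov-drop {x} {xs} {a} {M} h with (x ∪ M) ≟ M
  ... | yes x≼M = minus-zero _ (cov-absorb (h x≼M) (y≼x∪y a x))
  ... | no x⋠M  = minus-zero _ (cov-⋠ xs (x⋠M ∘ ≼-trans (y≼x∪y a x)))

  cov-↭ : ∀ {xs ys} → xs ↭ ys → ∀ a M → cov xs a M ≡ cov ys a M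
  cov-↭ Perm.refl a M = refl
  cov-↭ (Perm.prep x p) a M = cong₂ ℚ._-_ (cov-↭ p a M) (cov-↭ p (a ∪ x) M)
  cov-↭ (Perm.swap {xs} {ys} x y p) a M = begin
    (cov xs a M ℚ.- cov xs (a ∪ y) M) ℚ.- (cov xs (a ∪ x) M ℚ.- cov xs ((a ∪ x) ∪ y) M)
      ≡⟨ cong₂ ℚ._-_ (cong₂ ℚ._-_ (cov-↭ p a M) (cov-↭ p (a ∪ y) M))
                     (cong₂ ℚ._-_ (cov-↭ p (a ∪ x) M) (trans (cov-↭ p ((a ∪ x) ∪ y) M) (cong (λ b → cov ys b M) swap∪))) ⟩
    (A₀ ℚ.- Y) ℚ.- (X ℚ.- XY)          ≡⟨ exchange A₀ Y X XY ⟩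
    (A₀ ℚ.- X) ℚ.- (Y ℚ.- XY)          ∎
    where
    open ≡-Reasoning
    open ℚSolver.+-*-Solver using (solve; _:-_; _:=_)
    A₀ X Y XY : ℚ
    A₀ = cov ys a M
    X  = cov ys (a ∪ x) M
    Y  = cov ys (a ∪ y) M
    XY = cov ys ((a ∪ y) ∪ x) M
    swap∪ : (a ∪ x) ∪ y ≡ (a ∪ y) ∪ x
    swap∪ = trans (assoc a x y) (trans (cong (a ∪_) (comm x y)) (sym (assoc a y x)))
    exchange : ∀ p q r s → (p ℚ.- q) ℚ.- (r ℚ.- s) ≡ (p ℚ.- r) ℚ.- (q ℚ.- s)
    exchange = solve 4 (λ p q r s → (p :- q) :- (r :- s) := (p :- r) :- (q :- s)) refl
  cov-↭ (Perm.trans p q) a M = trans (cov-↭ p a M) (cov-↭ q a M)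

  cov-++ : ∀ {ys xs a M} → (∀ {y} → y ∈ ys → y ≼ M → y ∈ xs) → cov (ys ++ xs) a M ≡ cov xs a M
  cov-++ {[]}     _ = refl
  cov-++ {y ∷ ys} h = trans (cov-drop (∈-++⁺ʳ ys ∘ h (here refl))) (cov-++ (h ∘ there))

  -- Both sides equal the sum for the concatenated list: a member that is not below `M` contributes
  -- nothing, and one below `M` is a repetition.
  cov-set : ∀ {xs ys a M} → (∀ {x} → x ∈ xs → x ≼ M → x ∈ ys) → (∀ {y} → y ∈ ys → y ≼ M → y ∈ xs) →
            cov xs a M ≡ cov ys a M
  cov-set {xs} {ys} {a} {M} to from = trans (sym (cov-++ from)) (trans (cov-↭ (++-comm ys xs) a M) (cov-++ to))

  sum-δ : ∀ {a ys} → Unique ys → a ∈ ys → sumℚ (δ a) ys ≡ 1ℚ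
  sum-δ {a} {y ∷ ys} (n ∷ u) (here refl) =
    cong₂ ℚ._+_ (δ-refl a) (sumℚ-zero ys λ p → δ-≢ (All.lookup n p))
  sum-δ {a} {y ∷ ys} (n ∷ u) (there p) =
    cong₂ ℚ._+_ (δ-≢ (λ e → All.lookup n p (sym e))) (sum-δ u p)

  -- Summing over `M` lifts the condition on the union and leaves the alternating count of all
  -- sublists of `xs`. For this `ys` must contain every union that occurs.
  sum-cov : ∀ xs {a ys} → Unique ys → (∀ {M} → M ∈ unions xs a → M ∈ ys) → sumℚ (cov xs a) ys ≡ emptyIndicator xs
  sum-cov [] u sub = sum-δ u (sub (here refl))
  sum-cov (x ∷ xs) {a} {ys} u sub = trans (sumℚ-minus (cov xs a) (cov xs (a ∪ x)) ys)
    (trans (cong₂ ℚ._-_ (sum-cov xs u (sub ∘ ∈-++⁺ˡ)) (sum-cov xs u (sub ∘ ∈-++⁺ʳ (unions xs a)))) (ℚP.+-inverseʳ (emptyIndicator xs)))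

  cov⁺-set : ∀ {xs ys a M} → (∀ {x} → x ∈ xs → x ≼ M → x ∈ ys) → (∀ {y} → y ∈ ys → y ≼ M → y ∈ xs) →
             cov⁺ xs a M ≡ cov⁺ ys a M
  cov⁺-set {a = a} {M} to from = cong (λ c → δ a M ℚ.- c) (cov-set to from)

  cov⁺-start : ∀ xs {a} → (∀ {x} → x ∈ xs → ¬ x ≼ a) → cov⁺ xs a a ≡ 0ℚ
  cov⁺-start xs {a} h = trans (cong (λ c → δ a a ℚ.- c) (cov-start xs h)) (ℚP.+-inverseʳ (δ a a))
    where
    cov-start : ∀ xs → (∀ {x} → x ∈ xs → ¬ x ≼ a) → cov xs a a ≡ δ a a
    cov-start []       _ = refl
    cov-start (x ∷ xs) h = trans (minus-zero _ (cov-⋠ xs (h (here refl) ∘ ≼-trans (y≼x∪y a x)))) (cov-start xs (h ∘ there))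

  sum-cov⁺ : ∀ xs {a ys} → Unique ys → (∀ {M} → M ∈ unions xs a → M ∈ ys) →
             sumℚ (cov⁺ xs a) ys ≡ 1ℚ ℚ.- emptyIndicator xs
  sum-cov⁺ xs {a} {ys} u sub = trans (sumℚ-minus (δ a) (cov xs a) ys)
    (cong₂ ℚ._-_ (sum-δ u (sub (a∈unions xs))) (sum-cov xs u sub))

module _ {A A′ : Set} {_∪_ : A → A → A} {_≟_ : DecidableEquality A}
  {_∪′_ : A′ → A′ → A′} {_≟′_ : DecidableEquality A′}
  {h : A → A′} (h-inj : ∀ {x y} → h x ≡ h y → x ≡ y) (h-∪ : ∀ x y → h (x ∪ y) ≡ (h x) ∪′ (h y)) where

  private
    module S  = SignedCovers _∪_ _≟_
    module S′ = SignedCovers _∪′_ _≟′_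

  δ-map : ∀ a M → S′.δ (h a) (h M) ≡ S.δ a M
  δ-map a M with a ≟ M
  ... | yes refl = S′.δ-refl (h a)
  ... | no n     = S′.δ-≢ (n ∘ h-inj)

  cov-map : ∀ xs a M → S′.cov (map h xs) (h a) (h M) ≡ S.cov xs a M
  cov-map [] a M = δ-map a M
  cov-map (x ∷ xs) a M = cong₂ ℚ._-_ (cov-map xs a M)
    (trans (cong (λ b → S′.cov (map h xs) b (h M)) (sym (h-∪ a x))) (cov-map xs (a ∪ x) M))

  cov⁺-map : ∀ xs a M → S′.cov⁺ (map h xs) (h a) (h M) ≡ S.cov⁺ xs a M
  cov⁺-map xs a M = cong₂ ℚ._-_ (δ-map a M) (cov-map xs a M)

-- Subsets and masks

module _ {n : ℕ} {P : Fin n → Set} (P? : ∀ x → Dec (P x)) where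

  setOf : Subset n
  setOf = tabulate (does ∘ P?)

  ∈-setOf⁺ : ∀ {x} → P x → x ∈ₛ setOf
  ∈-setOf⁺ {x} p = VecP.lookup⇒[]= x setOf (trans (VecP.lookup∘tabulate (does ∘ P?) x) (dec-true (P? x) p))

  ∈-setOf⁻ : ∀ {x} → x ∈ₛ setOf → P x
  ∈-setOf⁻ {x} x∈ with P? x | trans (sym (VecP.lookup∘tabulate (does ∘ P?) x)) (VecP.[]=⇒lookup x∈)
  ... | yes p | _ = p

module _ {a b : ℕ} (f : Fin a → Fin b) where

  -- Unfolds to the components of `image`, so facts about `range` apply to images of embeddings
  -- without conversion.
  range : Subset b
  range = setOf (λ y → any? (λ x → f x Fin.≟ y))

  ∈-range⁺ : ∀ x → f x ∈ₛ range
  ∈-range⁺ x = ∈-setOf⁺ (λ y → any? (λ x → f x Fin.≟ y)) (x , refl)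

  ∈-range : ∀ {y} → ∃[ x ] f x ≡ y → y ∈ₛ range
  ∈-range (x , refl) = ∈-range⁺ x

  ∈-range⁻ : ∀ {y} → y ∈ₛ range → ∃[ x ] f x ≡ y
  ∈-range⁻ = ∈-setOf⁻ (λ y → any? (λ x → f x Fin.≟ y))

  directImage : Subset a → Subset b
  directImage p = setOf (λ y → any? (λ x → (x ∈? p) ×-dec (f x Fin.≟ y)))

  ∈-directImage⁺ : ∀ {p x} → x ∈ₛ p → f x ∈ₛ directImage p
  ∈-directImage⁺ {p} {x} x∈ = ∈-setOf⁺ (λ y → any? (λ x → (x ∈? p) ×-dec (f x Fin.≟ y))) (x , x∈ , refl)

  ∈-directImage⁻ : ∀ {p y} → y ∈ₛ directImage p → ∃[ x ] x ∈ₛ p × f x ≡ y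
  ∈-directImage⁻ {p} = ∈-setOf⁻ (λ y → any? (λ x → (x ∈? p) ×-dec (f x Fin.≟ y)))

  directImage-∪ : ∀ p q → directImage (p ∪ q) ≡ directImage p ∪ directImage q
  directImage-∪ p q = ⊆-antisym
    (λ y∈ → let (x , x∈ , e) = ∈-directImage⁻ y∈ in subst (_∈ₛ _) e
      (x∈p∪q⁺ ([ inj₁ ∘ ∈-directImage⁺ , inj₂ ∘ ∈-directImage⁺ ]′ (x∈p∪q⁻ p q x∈))))
    (λ y∈ → [ (λ y∈p → let (x , x∈ , e) = ∈-directImage⁻ y∈p in subst (_∈ₛ _) e (∈-directImage⁺ (x∈p∪q⁺ (inj₁ x∈))))
            , (λ y∈q → let (x , x∈ , e) = ∈-directImage⁻ y∈q in subst (_∈ₛ _) e (∈-directImage⁺ (x∈p∪q⁺ (inj₂ x∈)))) ]′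
      (x∈p∪q⁻ (directImage p) (directImage q) y∈))

  directImage-∅ : directImage ∅ ≡ ∅
  directImage-∅ = ⊆-antisym (λ y∈ → let (x , x∈ , e) = ∈-directImage⁻ {∅} y∈ in contradiction x∈ ∉⊥) (λ y∈ → contradiction y∈ ∉⊥)

  directImage-full : directImage full ≡ range
  directImage-full = ⊆-antisym
    (λ y∈ → let (x , x∈ , e) = ∈-directImage⁻ {full} y∈ in subst (_∈ₛ _) e (∈-range⁺ x))
    (λ y∈ → let (x , e) = ∈-range⁻ y∈ in subst (_∈ₛ _) e (∈-directImage⁺ ∈⊤))

  directImage-inj : Inj f → ∀ {p q} → directImage p ≡ directImage q → p ≡ q
  directImage-inj inj {p} {q} eq = ⊆-antisym (half eq) (half (sym eq))
    where
    half : ∀ {p q} → directImage p ≡ directImage q → p ⊆ q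
    half {p} {q} eq x∈ with z , z∈ , e ← ∈-directImage⁻ {q} (subst (f _ ∈ₛ_) eq (∈-directImage⁺ x∈)) =
      subst (_∈ₛ q) (inj _ _ e) z∈

  directImage-preimage : ∀ {q} → q ⊆ range → ∃[ p ] directImage p ≡ q
  directImage-preimage {q} sub = setOf f∈q? , ⊆-antisym
    (λ y∈ → let (x , x∈ , e) = ∈-directImage⁻ {setOf f∈q?} y∈ in subst (_∈ₛ q) e (∈-setOf⁻ f∈q? x∈))
    (λ y∈ → let (x , e) = ∈-range⁻ (sub y∈) in
      subst (_∈ₛ _) e (∈-directImage⁺ (∈-setOf⁺ f∈q? (subst (_∈ₛ q) (sym e) y∈))))
    where
    f∈q? : ∀ x → Dec (f x ∈ₛ q)
    f∈q? x = f x ∈? q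

range-∘ : ∀ {a b c} (f : Fin b → Fin c) (g : Fin a → Fin b) → directImage f (range g) ≡ range (f ∘ g)
range-∘ f g = ⊆-antisym
  (λ y∈ → let (x , x∈ , e) = ∈-directImage⁻ f {range g} y∈ ; (z , e′) = ∈-range⁻ g x∈ in
    subst (_∈ₛ _) (trans (cong f e′) e) (∈-range⁺ (f ∘ g) z))
  (λ y∈ → let (z , e) = ∈-range⁻ (f ∘ g) y∈ in subst (_∈ₛ _) e (∈-directImage⁺ f (∈-range⁺ g z)))

range-cong : ∀ {a b} {f g : Fin a → Fin b} → (∀ x → f x ≡ g x) → range f ≡ range g
range-cong {f = f} {g} eq = ⊆-antisym
  (λ y∈ → let (x , e) = ∈-range⁻ f y∈ in subst (_∈ₛ _) (trans (sym (eq x)) e) (∈-range⁺ g x))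
  (λ y∈ → let (x , e) = ∈-range⁻ g y∈ in subst (_∈ₛ _) (trans (eq x) e) (∈-range⁺ f x))

subsets : ∀ n → List (Subset n)
subsets zero    = [] ∷ []
subsets (suc n) = map (inside ∷_) (subsets n) ++ map (outside ∷_) (subsets n)

∈-subsets : ∀ {n} (p : Subset n) → p ∈ subsets n
∈-subsets []            = here refl
∈-subsets (true  ∷ p)   = ∈-++⁺ˡ (∈-map⁺ (inside ∷_) (∈-subsets p))
∈-subsets (false ∷ p)   = ∈-++⁺ʳ (map (inside ∷_) (subsets _)) (∈-map⁺ (outside ∷_) (∈-subsets p))

-- Supplies the numbering of vertices and oriented edges when a mask is turned into a graph.
enumerate : ∀ {n} (p : Subset n) →
  ∃[ k ] Σ (Fin k → Fin n) λ ι → Inj ι × (∀ j → ι j ∈ₛ p) × (∀ {x} → x ∈ₛ p → ∃[ j ] ι j ≡ x)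
enumerate [] = 0 , (λ ()) , (λ ()) , (λ ()) , λ ()
enumerate {suc n} (false ∷ p) with k , ι , inj , mem , sur ← enumerate p =
  k , Fin.suc ∘ ι , (λ x y e → inj x y (FinP.suc-injective e)) , (λ j → Vec.there (mem j)) ,
  λ { (Vec.there x∈) → let (j , e) = sur x∈ in j , cong Fin.suc e }
enumerate {suc n} (true ∷ p) with k , ι , inj , mem , sur ← enumerate p =
  suc k , ι′ , inj′ , mem′ , sur′
  where
  ι′ : Fin (suc k) → Fin (suc n)
  ι′ Fin.zero    = Fin.zero
  ι′ (Fin.suc j) = Fin.suc (ι j)
  inj′ : Inj ι′
  inj′ Fin.zero    Fin.zero    _ = refl
  inj′ (Fin.suc x) (Fin.suc y) e = cong Fin.suc (inj x y (FinP.suc-injective e))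
  mem′ : ∀ j → ι′ j ∈ₛ (true ∷ p)
  mem′ Fin.zero    = Vec.here
  mem′ (Fin.suc j) = Vec.there (mem j)
  sur′ : ∀ {x} → x ∈ₛ (true ∷ p) → ∃[ j ] ι′ j ≡ x
  sur′ Vec.here       = Fin.zero , refl
  sur′ (Vec.there x∈) = let (j , e) = sur x∈ in Fin.suc j , cong Fin.suc e

∈-allFuns : ∀ a b (f : Fin a → Fin b) → ∃[ g ] g ∈ allFuns a b × (∀ x → g x ≡ f x)
∈-allFuns zero    b f = _ , here refl , λ ()
∈-allFuns (suc a) b f with g , g∈ , eq ← ∈-allFuns a b (f ∘ Fin.suc) =
  _ , ∈-concatMap⁺ _ (Any.map (λ { refl → ∈-map⁺ _ (∈-allFin (f Fin.zero)) }) g∈) ,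
  λ { Fin.zero → refl ; (Fin.suc x) → eq x }

-- Arbitrary sets of vertices and oriented edges; those of subgraphs are the Closed ones.
Mask : ℕ → ℕ → Set
Mask n d = Subset n × Subset d

module _ {n d : ℕ} where

  infixr 6 _⊔_
  infix 4 _⊑_ _≟ₘ_

  _⊔_ : Mask n d → Mask n d → Mask n d
  (p , q) ⊔ (p′ , q′) = p ∪ p′ , q ∪ q′

  _⊑_ : Mask n d → Mask n d → Set
  (p , q) ⊑ (p′ , q′) = p ⊆ p′ × q ⊆ q′

  _≟ₘ_ : DecidableEquality (Mask n d)
  _≟ₘ_ = ProdP.≡-dec (VecP.≡-dec Bool._≟_) (VecP.≡-dec Bool._≟_)

  ⊑-refl : ∀ {M : Mask n d} → M ⊑ M
  ⊑-refl = id , id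

  ⊑-trans : ∀ {L M N : Mask n d} → L ⊑ M → M ⊑ N → L ⊑ N
  ⊑-trans (a , b) (c , d) = c ∘ a , d ∘ b

  ⊑-antisym : ∀ {M N : Mask n d} → M ⊑ N → N ⊑ M → M ≡ N
  ⊑-antisym (a , b) (c , d) = cong₂ _,_ (⊆-antisym a c) (⊆-antisym b d)

  ⊑-⊔ˡ : ∀ (M N : Mask n d) → M ⊑ M ⊔ N
  ⊑-⊔ˡ M N = (x∈p∪q⁺ ∘ inj₁) , (x∈p∪q⁺ ∘ inj₁)

  ⊑-⊔ʳ : ∀ (M N : Mask n d) → N ⊑ M ⊔ N
  ⊑-⊔ʳ M N = (x∈p∪q⁺ ∘ inj₂) , (x∈p∪q⁺ ∘ inj₂)

-- Heads are covered too, since `hd g e` is the tail of `inv g e`.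
Closed : (g : Graph) → Mask (nV g) (nD g) → Set
Closed g (p , q) = ∀ {e} → e ∈ₛ q → inv g e ∈ₛ q × tl g e ∈ₛ p

-- Embeddings and subgraphs

infix 4 _↪_

record _↪_ {B : Graph} (ψ G : BGraph B) : Set where
  constructor mk↪
  field
    emb   : Emb ψ G
    isEmb : IsBEmb ψ G (proj₁ emb) (proj₂ emb)

  onV : Fin (nV (gr ψ)) → Fin (nV (gr G))
  onV = proj₁ emb

  onD : Fin (nD (gr ψ)) → Fin (nD (gr G))
  onD = proj₂ emb

  comm-hd : ∀ e → hd (gr G) (onD e) ≡ onV (hd (gr ψ) e)
  comm-hd = proj₁ (proj₁ (proj₁ isEmb))

  comm-tl : ∀ e → tl (gr G) (onD e) ≡ onV (tl (gr ψ) e)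
  comm-tl = proj₁ (proj₂ (proj₁ (proj₁ isEmb)))

  comm-inv : ∀ e → inv (gr G) (onD e) ≡ onD (inv (gr ψ) e)
  comm-inv = proj₂ (proj₂ (proj₁ (proj₁ isEmb)))

  comm-πV : ∀ v → mapV (π G) (onV v) ≡ mapV (π ψ) v
  comm-πV = proj₁ (proj₂ (proj₁ isEmb))

  comm-πD : ∀ e → mapD (π G) (onD e) ≡ mapD (π ψ) e
  comm-πD = proj₂ (proj₂ (proj₁ isEmb))

  injV : Inj onV
  injV = proj₁ (proj₂ isEmb)

  injD : Inj onD
  injD = proj₂ (proj₂ isEmb)

open _↪_

module _ {B : Graph} where

  module _ {ψ G : BGraph B} where

    im : ψ ↪ G → Mask (nV (gr G)) (nD (gr G))
    im f = image {ψ = ψ} {G = G} (emb f)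

    push : ψ ↪ G → Mask (nV (gr ψ)) (nD (gr ψ)) → Mask (nV (gr G)) (nD (gr G))
    push f (p , q) = directImage (onV f) p , directImage (onD f) q

    ↪-resp : (f : ψ ↪ G) (g : Emb ψ G) → (∀ x → proj₁ g x ≡ onV f x) → (∀ x → proj₂ g x ≡ onD f x) →
             IsBEmb ψ G (proj₁ g) (proj₂ g)
    ↪-resp f (gV , gD) eV eD =
      ( ( (λ e → trans (cong (hd (gr G)) (eD e)) (trans (comm-hd f e) (sym (eV _))))
        , (λ e → trans (cong (tl (gr G)) (eD e)) (trans (comm-tl f e) (sym (eV _))))
        , (λ e → trans (cong (inv (gr G)) (eD e)) (trans (comm-inv f e) (sym (eD _)))))
      , (λ v → trans (cong (mapV (π G)) (eV v)) (comm-πV f v))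
      , (λ e → trans (cong (mapD (π G)) (eD e)) (comm-πD f e)) )
      , (λ x y e → injV f x y (trans (sym (eV x)) (trans e (eV y))))
      , (λ x y e → injD f x y (trans (sym (eD x)) (trans e (eD y))))

    embedding-of : ∀ {g} → g ∈ embeddings ψ G → ψ ↪ G
    embedding-of {g} g∈ = mk↪ g (proj₂ (∈-filter⁻ (λ f → isBEmb? ψ G (proj₁ f) (proj₂ f))
      {xs = List.cartesianProduct (allFuns (nV (gr ψ)) (nV (gr G))) (allFuns (nD (gr ψ)) (nD (gr G)))} g∈))

    -- Without function extensionality an embedding is listed only up to pointwise equality.
    ∈-embeddings : (f : ψ ↪ G) →
      ∃[ g ] g ∈ embeddings ψ G × (∀ x → proj₁ g x ≡ onV f x) × (∀ x → proj₂ g x ≡ onD f x)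
    ∈-embeddings f with gV , gV∈ , eV ← ∈-allFuns _ _ (onV f) | gD , gD∈ , eD ← ∈-allFuns _ _ (onD f) =
      (gV , gD) ,
      ∈-filter⁺ (λ f → isBEmb? ψ G (proj₁ f) (proj₂ f)) (∈-cartesianProduct⁺ gV∈ gD∈) (↪-resp f (gV , gD) eV eD) ,
      eV , eD

  copies : (ψ G : BGraph B) → List (Mask (nV (gr G)) (nD (gr G)))
  copies ψ G = map (image {ψ = ψ} {G = G}) (embeddings ψ G)

  ∈-copies⁺ : ∀ {ψ G : BGraph B} (f : ψ ↪ G) → im f ∈ copies ψ G
  ∈-copies⁺ {ψ} {G} f with g , g∈ , eV , eD ← ∈-embeddings f =
    subst (_∈ _) (cong₂ _,_ (range-cong eV) (range-cong eD)) (∈-map⁺ (image {ψ = ψ} {G = G}) g∈)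

  ∈-copies⁻ : ∀ (ψ G : BGraph B) {M} → M ∈ copies ψ G → Σ (ψ ↪ G) λ f → im f ≡ M
  ∈-copies⁻ ψ G M∈ with g , g∈ , eq ← ∈-map⁻ (image {ψ = ψ} {G = G}) M∈ = embedding-of {ψ} {G} g∈ , sym eq

  id↪ : ∀ (G : BGraph B) → G ↪ G
  id↪ G = mk↪ (id , id) ((((λ _ → refl) , (λ _ → refl) , (λ _ → refl)) , (λ _ → refl) , (λ _ → refl)) , (λ _ _ e → e) , (λ _ _ e → e))

  infixr 9 _∘↪_
  _∘↪_ : ∀ {φ ψ G : BGraph B} → ψ ↪ G → φ ↪ ψ → φ ↪ G
  f ∘↪ g = mk↪ (onV f ∘ onV g , onD f ∘ onD g)
    ((((λ e → trans (comm-hd f _) (cong (onV f) (comm-hd g e))) ,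
       (λ e → trans (comm-tl f _) (cong (onV f) (comm-tl g e))) ,
       (λ e → trans (comm-inv f _) (cong (onD f) (comm-inv g e)))) ,
      (λ v → trans (comm-πV f _) (comm-πV g v)) ,
      (λ e → trans (comm-πD f _) (comm-πD g e))) ,
     (λ x y e → injV g x y (injV f _ _ e)) ,
     (λ x y e → injD g x y (injD f _ _ e)))

  push-im : ∀ {φ ψ G : BGraph B} (f : ψ ↪ G) (g : φ ↪ ψ) → push f (im g) ≡ im (f ∘↪ g)
  push-im f g = cong₂ _,_ (range-∘ (onV f) (onV g)) (range-∘ (onD f) (onD g))

  -- `h` picks preimages under `f` of the values of `g`. Each law for `h` is the law for `g` after
  -- cancelling the injective `f`.
  factor : ∀ {φ ψ G : BGraph B} (f : ψ ↪ G) (g : φ ↪ G) → im g ⊑ im f →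
    Σ (φ ↪ ψ) λ h → (∀ v → onV f (onV h v) ≡ onV g v) × (∀ e → onD f (onD h e) ≡ onD g e)
  factor {φ} {ψ} {G} f g (subV , subD) = mk↪ (hV , hD)
    ((((λ e → injV f _ _ (trans (sym (comm-hd f _)) (trans (cong (hd (gr G)) (fhD e)) (trans (comm-hd g e) (sym (fhV _)))))) ,
       (λ e → injV f _ _ (trans (sym (comm-tl f _)) (trans (cong (tl (gr G)) (fhD e)) (trans (comm-tl g e) (sym (fhV _)))))) ,
       (λ e → injD f _ _ (trans (sym (comm-inv f _)) (trans (cong (inv (gr G)) (fhD e)) (trans (comm-inv g e) (sym (fhD _))))))) ,
      (λ v → trans (sym (comm-πV f _)) (trans (cong (mapV (π G)) (fhV v)) (comm-πV g v))) ,
      (λ e → trans (sym (comm-πD f _)) (trans (cong (mapD (π G)) (fhD e)) (comm-πD g e)))) ,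
     (λ x y e → injV g x y (trans (sym (fhV x)) (trans (cong (onV f) e) (fhV y)))) ,
     (λ x y e → injD g x y (trans (sym (fhD x)) (trans (cong (onD f) e) (fhD y))))) ,
    fhV , fhD
    where
    hV : Fin (nV (gr φ)) → Fin (nV (gr ψ))
    hV v = proj₁ (∈-range⁻ (onV f) (subV (∈-range⁺ (onV g) v)))
    hD : Fin (nD (gr φ)) → Fin (nD (gr ψ))
    hD e = proj₁ (∈-range⁻ (onD f) (subD (∈-range⁺ (onD g) e)))
    fhV : ∀ v → onV f (hV v) ≡ onV g v
    fhV v = proj₂ (∈-range⁻ (onV f) (subV (∈-range⁺ (onV g) v)))
    fhD : ∀ e → onD f (hD e) ≡ onD g e
    fhD e = proj₂ (∈-range⁻ (onD f) (subD (∈-range⁺ (onD g) e)))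

  im-∘-⊑ : ∀ {φ ψ G : BGraph B} (f : ψ ↪ G) (g : φ ↪ ψ) → im (f ∘↪ g) ⊑ im f
  im-∘-⊑ f g =
    (λ y∈ → let (x , e) = ∈-range⁻ (onV f ∘ onV g) y∈ in ∈-range (onV f) (onV g x , e)) ,
    (λ y∈ → let (x , e) = ∈-range⁻ (onD f ∘ onD g) y∈ in ∈-range (onD f) (onD g x , e))

  -- One embedding factors through the other, and the equality of images makes the factor
  -- surjective.
  same-image⇒iso : ∀ {φ ψ G : BGraph B} (f : φ ↪ G) (g : ψ ↪ G) → im f ≡ im g → BIso φ ψ
  same-image⇒iso f g eq
    with h , ghV , ghD ← factor g f (subst (im f ⊑_) eq ⊑-refl) =
    onV h , onD h , isEmb h ,
    (λ y → let (x , e) = ∈-range⁻ (onV f) (subst (onV g y ∈ₛ_) (sym (cong proj₁ eq)) (∈-range⁺ (onV g) y))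
           in x , injV g _ _ (trans (ghV x) e)) ,
    (λ y → let (x , e) = ∈-range⁻ (onD f) (subst (onD g y ∈ₛ_) (sym (cong proj₂ eq)) (∈-range⁺ (onD g) y))
           in x , injD g _ _ (trans (ghD x) e))

  module _ (ψ φ : BGraph B) (i : BIso ψ φ) where

    iso⇒↪ : ψ ↪ φ
    iso⇒↪ = mk↪ (proj₁ i , proj₁ (proj₂ i)) (proj₁ (proj₂ (proj₂ i)))

    im-iso : im iso⇒↪ ≡ im (id↪ φ)
    im-iso = ⊑-antisym
      ((λ _ → ∈-range⁺ id _) , (λ _ → ∈-range⁺ id _))
      ((λ {y} _ → ∈-range (onV iso⇒↪) (proj₁ (proj₂ (proj₂ (proj₂ i))) y)) ,
       (λ {y} _ → ∈-range (onD iso⇒↪) (proj₂ (proj₂ (proj₂ (proj₂ i))) y)))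

    -- The inverse comes from comparing images: the isomorphism and the identity both fill φ.
    BIso-sym : BIso φ ψ
    BIso-sym = same-image⇒iso (id↪ φ) iso⇒↪ (sym im-iso)

  transport↪ : ∀ {ψ φ G : BGraph B} → BIso ψ φ → (f : ψ ↪ G) → Σ (φ ↪ G) λ g → im g ≡ im f
  transport↪ {ψ} {φ} i f = f ∘↪ j , trans (sym (push-im f j)) (trans (cong (push f) (im-iso φ ψ (BIso-sym ψ φ i))) (push-im f (id↪ ψ)))
    where
    j : φ ↪ ψ
    j = iso⇒↪ φ ψ (BIso-sym ψ φ i)

  im-closed : ∀ {ψ G : BGraph B} (f : ψ ↪ G) → Closed (gr G) (im f)
  im-closed {ψ} {G} f e∈ with x , refl ← ∈-range⁻ (onD f) e∈ =
    ∈-range (onD f) (_ , sym (comm-inv f x)) , ∈-range (onV f) (_ , sym (comm-tl f x))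

  -- Converse of `im-closed`: the members of the mask are renumbered, and closedness keeps tails,
  -- heads and inverses inside it.
  subgraph : ∀ {G : BGraph B} {M} → Closed (gr G) M → Σ (BGraph B) λ ψ → Σ (ψ ↪ G) λ f → im f ≡ M
  subgraph {G} {p , q} closed
    with n , ι , ι-inj , ι-mem , ι-sur ← enumerate p | d , κ , κ-inj , κ-mem , κ-sur ← enumerate q =
    ψ , f , ⊑-antisym
      ((λ y∈ → let (x , e) = ∈-range⁻ ι y∈ in subst (_∈ₛ p) e (ι-mem x)) ,
       (λ y∈ → let (x , e) = ∈-range⁻ κ y∈ in subst (_∈ₛ q) e (κ-mem x)))
      ((λ y∈ → let (x , e) = ι-sur y∈ in ∈-range ι (x , e)) ,
       (λ y∈ → let (x , e) = κ-sur y∈ in ∈-range κ (x , e)))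
    where
    g = gr G
    tl∈ : ∀ j → tl g (κ j) ∈ₛ p
    tl∈ j = proj₂ (closed (κ-mem j))
    inv∈ : ∀ j → inv g (κ j) ∈ₛ q
    inv∈ j = proj₁ (closed (κ-mem j))
    hd∈ : ∀ j → hd g (κ j) ∈ₛ p
    hd∈ j = subst (_∈ₛ p) (tl-inv g (κ j)) (proj₂ (closed (inv∈ j)))
    inv′ : Fin d → Fin d
    inv′ j = proj₁ (κ-sur (inv∈ j))
    κ-inv′ : ∀ j → κ (inv′ j) ≡ inv g (κ j)
    κ-inv′ j = proj₂ (κ-sur (inv∈ j))
    g′ : Graph
    g′ = record
      { nV = n ; nD = d
      ; hd = λ j → proj₁ (ι-sur (hd∈ j))
      ; tl = λ j → proj₁ (ι-sur (tl∈ j))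
      ; inv = inv′
      ; inv-invol = λ j → κ-inj _ _ (trans (κ-inv′ (inv′ j)) (trans (cong (inv g) (κ-inv′ j)) (inv-invol g (κ j))))
      ; tl-inv = λ j → ι-inj _ _ (trans (proj₂ (ι-sur (tl∈ (inv′ j)))) (trans (cong (tl g) (κ-inv′ j))
                   (trans (tl-inv g (κ j)) (sym (proj₂ (ι-sur (hd∈ j)))))))
      }
    incl : IsHom g′ g ι κ
    incl = (λ j → sym (proj₂ (ι-sur (hd∈ j)))) , (λ j → sym (proj₂ (ι-sur (tl∈ j)))) , (λ j → sym (κ-inv′ j))
    ψ : BGraph B
    ψ = record { gr = g′ ; π = record { mapV = mapV (π G) ∘ ι ; mapD = mapD (π G) ∘ κ ; isHom =
      (λ e → trans (proj₁ (isHom (π G)) (κ e)) (cong (mapV (π G)) (proj₁ incl e))) ,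
      (λ e → trans (proj₁ (proj₂ (isHom (π G))) (κ e)) (cong (mapV (π G)) (proj₁ (proj₂ incl) e))) ,
      (λ e → trans (proj₂ (proj₂ (isHom (π G))) (κ e)) (cong (mapD (π G)) (proj₂ (proj₂ incl) e))) } }
    f : ψ ↪ G
    f = mk↪ (ι , κ) ((incl , (λ _ → refl) , (λ _ → refl)) , ι-inj , κ-inj)

-- Order of a subgraph

diff-mono : ∀ a b c d → a + d ℕ.≤ c + b → + a ℤ.- + b ℤ.≤ + c ℤ.- + d
diff-mono a b c d h = subst₂ ℤ._≤_ (shift a b d) (trans (cong (λ x → + (c + b) ℤ.- + x) (ℕP.+-comm b d)) (shift c d b))
  (ℤP.+-monoˡ-≤ (ℤ.- + (b + d)) (ℤ.+≤+ h))
  where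
  open ℤSolver.+-*-Solver using (solve; _:-_; _:+_; _:=_)
  shift : ∀ x y z → + (x + z) ℤ.- + (y + z) ≡ + x ℤ.- + y
  shift x y z = trans (cong₂ ℤ._-_ (ℤP.pos-+ x z) (ℤP.pos-+ y z))
    (solve 3 (λ x y z → (x :+ z) :- (y :+ z) := x :- y) refl (+ x) (+ y) (+ z))

sum-≥ : ∀ {A : Set} (f : A → ℕ) k xs → (∀ {x} → x ∈ xs → k ℕ.≤ f x) → length xs ℕ.* k ℕ.≤ sum (map f xs)
sum-≥ f k []       _ = z≤n
sum-≥ f k (x ∷ xs) h = ℕP.+-mono-≤ (h (here refl)) (sum-≥ f k xs (h ∘ there))

-- The predicate that always holds, which makes the size of `Fin n` an instance of `count`.
any-element? : ∀ {n} (x : Fin n) → Dec (x ≡ x)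
any-element? x = yes refl

count-any : ∀ n → count (any-element? {n}) ≡ n
count-any n = trans (cong length (ListP.filter-all any-element? (All.tabulate {xs = allFin n} λ _ → refl)))
                    (ListP.length-tabulate {n = n} id)

count-range-≤ : ∀ {a b} (f : Fin a → Fin b) → count (_∈? range f) ℕ.≤ a
count-range-≤ {a} f = subst (count (_∈? range f) ℕ.≤_) (count-any a) (count-surj any-element? (_∈? range f) f
  (λ y∈ → let (x , e) = ∈-range⁻ f y∈ in x , refl , e))

count-range : ∀ {a b} (f : Fin a → Fin b) → Inj f → count (_∈? range f) ≡ a
count-range {a} f inj = ℕP.≤-antisym (count-range-≤ f)
  (subst (ℕ._≤ count (_∈? range f)) (count-any a)
    (count-inj any-element? (_∈? range f) f (λ _ _ → inj _ _) (λ {x} _ → ∈-range⁺ f x)))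

module _ (g : Graph) where

  -- An embedding need not respect the numbering of oriented edges, so it may send the
  -- representative of an orbit to the wrong one of the two; `rep` corrects this.
  rep : Fin (nD g) → Fin (nD g)
  rep e with e FinP.≤? inv g e
  ... | yes _ = e
  ... | no _  = inv g e

  rep-≤ : ∀ e → rep e Fin.≤ inv g (rep e)
  rep-≤ e with e FinP.≤? inv g e
  ... | yes p = p
  ... | no n  = subst (inv g e Fin.≤_) (sym (inv-invol g e)) (ℕP.<⇒≤ (ℕP.≰⇒> n))

  rep-orbit : ∀ e → rep e ≡ e ⊎ rep e ≡ inv g e
  rep-orbit e with e FinP.≤? inv g e
  ... | yes _ = inj₁ refl
  ... | no _  = inj₂ refl

  orbit-unique : ∀ {e e′} → e Fin.≤ inv g e → e′ Fin.≤ inv g e′ → e ≡ e′ ⊎ e ≡ inv g e′ → e ≡ e′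
  orbit-unique p q (inj₁ e≡) = e≡
  orbit-unique {e} {e′} p q (inj₂ refl) =
    FinP.≤-antisym (subst (inv g e′ Fin.≤_) (inv-invol g e′) p) q

  edgeRep? : (q : Subset (nD g)) → ∀ e → Dec (e ∈ₛ q × e Fin.≤ inv g e)
  edgeRep? q e = (e ∈? q) ×-dec (e FinP.≤? inv g e)

  ordOf : Mask (nV g) (nD g) → ℤ
  ordOf (p , q) = + count (edgeRep? q) ℤ.- + count (_∈? p)

-- The edges are matched by `rep g ∘ onD f`, injective and surjective on orbit representatives since
-- `f` is injective and commutes with the involutions.
ordOf-im : ∀ {B} {ψ G : BGraph B} (f : ψ ↪ G) → ord (gr ψ) ≡ ordOf (gr G) (im f)
ordOf-im {ψ = ψ} {G} f = cong₂ (λ e v → + e ℤ.- + v) (ℕP.≤-antisym le ge) (sym (count-range (onV f) (injV f)))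
  where
  g h : Graph
  g = gr G
  h = gr ψ
  E? : ∀ e → Dec (e Fin.≤ inv h e)
  E? e = e FinP.≤? inv h e
  rep∈ : ∀ e → rep g (onD f e) ∈ₛ range (onD f)
  rep∈ e with rep-orbit g (onD f e)
  ... | inj₁ eq = ∈-range (onD f) (e , sym eq)
  ... | inj₂ eq = ∈-range (onD f) (inv h e , trans (sym (comm-inv f e)) (sym eq))
  rep-inj : ∀ {x y} → x Fin.≤ inv h x → y Fin.≤ inv h y → rep g (onD f x) ≡ rep g (onD f y) → x ≡ y
  rep-inj {x} {y} p q eq = orbit-unique h p q orbit
    where
    orbit : x ≡ y ⊎ x ≡ inv h y
    orbit with rep-orbit g (onD f x) | rep-orbit g (onD f y)
    ... | inj₁ a | inj₁ b = inj₁ (injD f _ _ (trans (sym a) (trans eq b)))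
    ... | inj₁ a | inj₂ b = inj₂ (injD f _ _ (trans (sym a) (trans eq (trans b (comm-inv f y)))))
    ... | inj₂ a | inj₁ b = inj₂ (trans (sym (inv-invol h x)) (cong (inv h)
                              (injD f _ _ (trans (sym (comm-inv f x)) (trans (sym a) (trans eq b))))))
    ... | inj₂ a | inj₂ b = inj₁ (trans (sym (inv-invol h x)) (trans (cong (inv h)
                              (injD f _ _ (trans (sym (comm-inv f x)) (trans (sym a) (trans eq (trans b (comm-inv f y))))))) (inv-invol h y)))
  le : count E? ℕ.≤ count (edgeRep? g (range (onD f)))
  le = count-inj E? (edgeRep? g (range (onD f))) (rep g ∘ onD f) rep-inj (λ {x} _ → rep∈ x , rep-≤ g (onD f x))
  ge : count (edgeRep? g (range (onD f))) ℕ.≤ count E?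
  ge = count-surj E? (edgeRep? g (range (onD f))) (rep g ∘ onD f) sur
    where
    sur : ∀ {y} → y ∈ₛ range (onD f) × y Fin.≤ inv g y → ∃[ x ] x Fin.≤ inv h x × rep g (onD f x) ≡ y
    sur {y} (y∈ , y≤) with x , refl ← ∈-range⁻ (onD f) y∈ =
      rep h x , rep-≤ h x , orbit-unique g (rep-≤ g (onD f (rep h x))) y≤ orbit
      where
      orbit : rep g (onD f (rep h x)) ≡ onD f x ⊎ rep g (onD f (rep h x)) ≡ inv g (onD f x)
      orbit with rep-orbit g (onD f (rep h x)) | rep-orbit h x
      ... | inj₁ a | inj₁ b = inj₁ (trans a (cong (onD f) b))
      ... | inj₁ a | inj₂ b = inj₂ (trans a (trans (cong (onD f) b) (sym (comm-inv f x))))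
      ... | inj₂ a | inj₁ b = inj₂ (trans a (cong (λ e → inv g (onD f e)) b))
      ... | inj₂ a | inj₂ b = inj₁ (trans a (trans (cong (inv g) (trans (cong (onD f) b) (sym (comm-inv f x)))) (inv-invol g (onD f x))))

module _ (g : Graph) where

  edgesAt? : (q : Subset (nD g)) (v : Fin (nV g)) → ∀ e → Dec (e ∈ₛ q × tl g e ≡ v)
  edgesAt? q v e = (e ∈? q) ×-dec (tl g e Fin.≟ v)

  -- Each new vertex is the tail of two oriented edges, which are new as well because H is closed.
  ordOf-mono : ∀ {H U} → Closed g H → Closed g U → H ⊑ U →
    (∀ {v} → v ∈ₛ proj₁ U → 2 ℕ.≤ count (edgesAt? (proj₂ U) v)) → ordOf g H ℤ.≤ ordOf g U
  ordOf-mono {p , q} {p′ , q′} cH cU (p⊆ , q⊆) deg =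
    -- With vertices and edges split into old and new ones, the claim reduces to `new≤`.
    diff-mono (count (edgeRep? g q)) (count (_∈? p)) (count (edgeRep? g q′)) (count (_∈? p′)) (begin
      count (edgeRep? g q) + count (_∈? p′)                  ≤⟨ ℕP.+-monoʳ-≤ (count (edgeRep? g q)) (count-⊎-≤ (_∈? p) newV? (_∈? p′) splitV) ⟩
      count (edgeRep? g q) + (count (_∈? p) + count newV?)   ≤⟨ ℕP.+-monoʳ-≤ (count (edgeRep? g q)) (ℕP.+-monoʳ-≤ (count (_∈? p)) new≤) ⟩
      count (edgeRep? g q) + (count (_∈? p) + count newE?)   ≡⟨ cong (λ n → count (edgeRep? g q) + n) (ℕP.+-comm (count (_∈? p)) (count newE?)) ⟩
      count (edgeRep? g q) + (count newE? + count (_∈? p))   ≡⟨ sym (ℕP.+-assoc (count (edgeRep? g q)) (count newE?) (count (_∈? p))) ⟩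
      (count (edgeRep? g q) + count newE?) + count (_∈? p)   ≤⟨ ℕP.+-monoˡ-≤ (count (_∈? p))
                                                              (count-⊎-≥ (edgeRep? g q) newE? (edgeRep? g q′) (λ (a , _) ((_ , b) , _) → b a) joinE) ⟩
      count (edgeRep? g q′) + count (_∈? p)                  ∎)
    where
    open ℕP.≤-Reasoning
    newV? : ∀ v → Dec (v ∈ₛ p′ × v ∉ₛ p)
    newV? v = (v ∈? p′) ×-dec ¬? (v ∈? p)
    newD? : ∀ e → Dec (e ∈ₛ q′ × e ∉ₛ q)
    newD? e = (e ∈? q′) ×-dec ¬? (e ∈? q)
    newE? : ∀ e → Dec ((e ∈ₛ q′ × e ∉ₛ q) × e Fin.≤ inv g e)
    newE? e = newD? e ×-dec (e FinP.≤? inv g e)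
    splitV : ∀ {v} → v ∈ₛ p′ → v ∈ₛ p ⊎ v ∈ₛ p′ × v ∉ₛ p
    splitV {v} v∈ with v ∈? p
    ... | yes y = inj₁ y
    ... | no n  = inj₂ (v∈ , n)
    joinE : ∀ {e} → (e ∈ₛ q × e Fin.≤ inv g e) ⊎ ((e ∈ₛ q′ × e ∉ₛ q) × e Fin.≤ inv g e) → e ∈ₛ q′ × e Fin.≤ inv g e
    joinE (inj₁ (a , b))       = q⊆ a , b
    joinE (inj₂ ((a , _) , b)) = a , b
    vs : List (Fin (nV g))
    vs = filter newV? (allFin (nV g))
    at : Fin (nV g) → List (Fin (nD g))
    at v = filter (edgesAt? q′ v) (allFin (nD g))
    at⁻ : ∀ {v e} → e ∈ at v → e ∈ₛ q′ × tl g e ≡ v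
    at⁻ {v} e∈ = proj₂ (∈-filter⁻ (edgesAt? q′ v) {xs = allFin (nD g)} e∈)
    at-new : ∀ {e} → e ∈ concatMap at vs → e ∈ₛ q′ × e ∉ₛ q
    at-new e∈ with v , v∈ , e∈v ← find (∈-concatMap⁻ at {xs = vs} e∈) with e∈q′ , refl ← at⁻ e∈v =
      e∈q′ , λ e∈q → proj₂ (proj₂ (∈-filter⁻ newV? {xs = allFin (nV g)} v∈)) (proj₂ (cH e∈q))
    at-unique : Unique (concatMap at vs)
    at-unique = concatMap-unique at (λ v → Uniq.filter⁺ (edgesAt? q′ v) (Uniq.allFin⁺ (nD g)))
      (λ v≢w a b → v≢w (trans (sym (proj₂ (at⁻ a))) (proj₂ (at⁻ b)))) (Uniq.filter⁺ newV? (Uniq.allFin⁺ (nV g)))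
    es : List (Fin (nD g))
    es = filter newE? (allFin (nD g))
    -- A new oriented edge that is not the representative of its orbit has a new inverse that is:
    -- `U` being closed puts the inverse in `U`, and `H` being closed keeps it out of `H`.
    es⁺ : ∀ {e} → e ∈ₛ q′ × e ∉ₛ q → e ∈ es ++ map (inv g) es
    es⁺ {e} (a , b) with e FinP.≤? inv g e
    ... | yes e≤ = ∈-++⁺ˡ (∈-filter⁺ newE? (∈-allFin e) ((a , b) , e≤))
    ... | no e≰  = ∈-++⁺ʳ es (subst (_∈ map (inv g) es) (inv-invol g e) (∈-map⁺ (inv g)
        (∈-filter⁺ newE? (∈-allFin (inv g e)) ((proj₁ (cU a) , b ∘ subst (_∈ₛ q) (inv-invol g e) ∘ proj₁ ∘ cH) ,
          subst (inv g e Fin.≤_) (sym (inv-invol g e)) (ℕP.<⇒≤ (ℕP.≰⇒> e≰))))))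
    -- Double counting of oriented edges with tail at a new vertex: there are at least two per new
    -- vertex, and at most two per new edge. An edge fixed by `inv` is merely listed twice.
    new≤ : count newV? ℕ.≤ count newE?
    new≤ = ℕP.*-cancelʳ-≤ (count newV?) (count newE?) 2 (begin
      length vs ℕ.* 2                    ≤⟨ sum-≥ (length ∘ at) 2 vs (λ v∈ → deg (proj₁ (proj₂ (∈-filter⁻ newV? {xs = allFin (nV g)} v∈)))) ⟩
      sum (map (length ∘ at) vs)         ≡⟨ sym (length-concatMap at vs) ⟩
      length (concatMap at vs)           ≤⟨ length-⊆ at-unique (es⁺ ∘ at-new) ⟩
      length (es ++ map (inv g) es)      ≡⟨ trans (ListP.length-++ es) (cong (λ n → length es + n) (ListP.length-map (inv g) es)) ⟩
      length es + length es              ≡⟨ cong (λ n → length es + n) (sym (ℕP.+-identityʳ (length es))) ⟩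
      2 ℕ.* length es                    ≡⟨ ℕP.*-comm 2 (length es) ⟩
      length es ℕ.* 2                    ∎)

  -- A crude estimate: the edges gained number at most the oriented edges of `N`, and additional
  -- vertices only lower the order.
  ordOf-⊔ : ∀ (M N : Mask (nV g) (nD g)) → ordOf g (M ⊔ N) ℤ.≤ ordOf g M ℤ.+ + count (_∈? proj₂ N)
  ordOf-⊔ (p , q) (p′ , q′) = subst (ordOf g (p ∪ p′ , q ∪ q′) ℤ.≤_)
    (trans (cong (ℤ._- + count (_∈? p)) (ℤP.pos-+ (count (edgeRep? g q)) (count (_∈? q′))))
      (solve 3 (λ x y z → (x :+ z) :- y := (x :- y) :+ z) refl (+ count (edgeRep? g q)) (+ count (_∈? p)) (+ count (_∈? q′))))
    (diff-mono (count (edgeRep? g (q ∪ q′))) (count (_∈? (p ∪ p′))) (count (edgeRep? g q) + count (_∈? q′)) (count (_∈? p))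
      (ℕP.+-mono-≤
        (count-⊎-≤ (edgeRep? g q) (_∈? q′) (edgeRep? g (q ∪ q′))
          (λ (a , b) → [ (λ a → inj₁ (a , b)) , inj₂ ]′ (x∈p∪q⁻ q q′ a)))
        (count-inj (_∈? p) (_∈? (p ∪ p′)) id (λ _ _ e → e) (x∈p∪q⁺ ∘ inj₁))))
    where open ℤSolver.+-*-Solver using (solve; _:-_; _:+_; _:=_)

-- Unions of copies

module _ {n d : ℕ} where

  ⊔-assoc : ∀ (L M N : Mask n d) → (L ⊔ M) ⊔ N ≡ L ⊔ (M ⊔ N)
  ⊔-assoc (p , q) (p′ , q′) (p″ , q″) = cong₂ _,_ (SubsetP.∪-assoc p p′ p″) (SubsetP.∪-assoc q q′ q″)

  ⊔-comm : ∀ (M N : Mask n d) → M ⊔ N ≡ N ⊔ M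
  ⊔-comm (p , q) (p′ , q′) = cong₂ _,_ (SubsetP.∪-comm p p′) (SubsetP.∪-comm q q′)

  ⊔-idem : ∀ (M : Mask n d) → M ⊔ M ≡ M
  ⊔-idem (p , q) = cong₂ _,_ (SubsetP.∪-idem p) (SubsetP.∪-idem q)

  ⊔-lub : ∀ {L M N : Mask n d} → L ⊑ N → M ⊑ N → L ⊔ M ⊑ N
  ⊔-lub {p , q} {p′ , q′} (a , b) (c , d) = ([ a , c ]′ ∘ x∈p∪q⁻ p p′) , ([ b , d ]′ ∘ x∈p∪q⁻ q q′)

  module Covers = SignedCovers (_⊔_ {n} {d}) _≟ₘ_
  module CoverLaws = SignedCoverLaws (_⊔_ {n} {d}) _≟ₘ_ ⊔-assoc ⊔-comm ⊔-idem

  ≼⇒⊑ : ∀ {M N : Mask n d} → M Covers.≼ N → M ⊑ N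
  ≼⇒⊑ {M} {N} eq = subst (M ⊑_) eq (⊑-⊔ˡ M N)

  -- A left fold, so the masks are added to `M` one by one and the intermediate unions are those
  -- that `crossing` inspects.
  joins : Mask n d → List (Mask n d) → Mask n d
  joins = List.foldl _⊔_

  ⊑-joins : ∀ {M} xs → M ⊑ joins M xs
  ⊑-joins []           = ⊑-refl
  ⊑-joins {M} (x ∷ xs) = ⊑-trans (⊑-⊔ˡ M x) (⊑-joins xs)

  ∈-joins : ∀ {M x xs} → x ∈ xs → x ⊑ joins M xs
  ∈-joins {M} {x} {_ ∷ xs} (here refl) = ⊑-trans (⊑-⊔ʳ M x) (⊑-joins xs)
  ∈-joins (there p)                    = ∈-joins p

  joins-⊑ : ∀ {M N} xs → M ⊑ N → (∀ {x} → x ∈ xs → x ⊑ N) → joins M xs ⊑ N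
  joins-⊑ []       M⊑N _ = M⊑N
  joins-⊑ (x ∷ xs) M⊑N h = joins-⊑ xs (⊔-lub M⊑N (h (here refl))) (h ∘ there)

masks : ∀ n d → List (Mask n d)
masks n d = List.cartesianProduct (subsets n) (subsets d)

∈-masks : ∀ {n d} (M : Mask n d) → M ∈ masks n d
∈-masks (p , q) = ∈-cartesianProduct⁺ (∈-subsets p) (∈-subsets q)

-- Subgraphs isomorphic to given graphs, and masks pushed along embeddings

module _ {B : Graph} where

  -- The list whose length is, by definition, `#sub ψ G`.
  subcopies : (ψ G : BGraph B) → List (Mask (nV (gr G)) (nD (gr G)))
  subcopies ψ G = deduplicate _≟ₘ_ (copies ψ G)

  ∈-subcopies⁺ : ∀ {ψ G : BGraph B} (f : ψ ↪ G) → im f ∈ subcopies ψ G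
  ∈-subcopies⁺ f = ∈-deduplicate⁺ _≟ₘ_ (∈-copies⁺ f)

  ∈-subcopies⁻ : ∀ (ψ G : BGraph B) {M} → M ∈ subcopies ψ G → Σ (ψ ↪ G) λ f → im f ≡ M
  ∈-subcopies⁻ ψ G M∈ = ∈-copies⁻ ψ G (∈-deduplicate⁻ _≟ₘ_ (copies ψ G) M∈)

  allSubcopies : List (BGraph B) → (G : BGraph B) → List (Mask (nV (gr G)) (nD (gr G)))
  allSubcopies L G = concatMap (λ ψ → subcopies ψ G) L

  ∈-allSubcopies⁺ : ∀ {L ψ} {G : BGraph B} → ψ ∈ L → (f : ψ ↪ G) → im f ∈ allSubcopies L G
  ∈-allSubcopies⁺ {G = G} ψ∈ f = ∈-concatMap⁺ (λ ψ → subcopies ψ G) (lose ψ∈ (∈-subcopies⁺ f))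

  ∈-allSubcopies⁻ : ∀ L (G : BGraph B) {M} → M ∈ allSubcopies L G →
    ∃[ ψ ] ψ ∈ L × Σ (ψ ↪ G) λ f → im f ≡ M
  ∈-allSubcopies⁻ L G M∈ with ψ , ψ∈ , M∈ψ ← find (∈-concatMap⁻ (λ ψ → subcopies ψ G) {xs = L} M∈) =
    ψ , ψ∈ , ∈-subcopies⁻ ψ G M∈ψ

  -- A subgraph listed for two members of `L` would make them isomorphic. Hence sums over classes
  -- weighted by `#sub` are sums over subgraphs of G.
  allSubcopies-unique : ∀ {L} (G : BGraph B) → AllPairs (λ φ φ′ → ¬ BIso φ φ′) L → Unique (allSubcopies L G)
  allSubcopies-unique G = concatMap-unique (λ ψ → subcopies ψ G) (λ ψ → deduplicate-! _≟ₘ_ (copies ψ G))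
    λ {ψ} {φ} ¬iso a b → let (f , e) = ∈-subcopies⁻ ψ G a ; (g , e′) = ∈-subcopies⁻ φ G b in
      ¬iso (same-image⇒iso f g (trans e (sym e′)))

  none whole : (G : BGraph B) → Mask (nV (gr G)) (nD (gr G))
  none  G = ∅ , ∅
  whole G = full , full

  none-⊔ : ∀ {G : BGraph B} M → none G ⊔ M ≡ M
  none-⊔ (p , q) = cong₂ _,_ (SubsetP.∪-identityˡ p) (SubsetP.∪-identityˡ q)

  push-none : ∀ {ψ G : BGraph B} (f : ψ ↪ G) → push f (none ψ) ≡ none G
  push-none f = cong₂ _,_ (directImage-∅ (onV f)) (directImage-∅ (onD f))

  push-whole : ∀ {ψ G : BGraph B} (f : ψ ↪ G) → push f (whole ψ) ≡ im f
  push-whole f = cong₂ _,_ (directImage-full (onV f)) (directImage-full (onD f))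

  push-inj : ∀ {ψ G : BGraph B} (f : ψ ↪ G) {M N} → push f M ≡ push f N → M ≡ N
  push-inj f eq = cong₂ _,_ (directImage-inj (onV f) (injV f) (cong proj₁ eq)) (directImage-inj (onD f) (injD f) (cong proj₂ eq))

  push-⊔ : ∀ {ψ G : BGraph B} (f : ψ ↪ G) M N → push f (M ⊔ N) ≡ push f M ⊔ push f N
  push-⊔ f (p , q) (p′ , q′) = cong₂ _,_ (directImage-∪ (onV f) p p′) (directImage-∪ (onD f) q q′)

  push-preimage : ∀ {ψ G : BGraph B} (f : ψ ↪ G) {M} → M ⊑ im f → ∃[ N ] push f N ≡ M
  push-preimage f (a , b) =
    let (p , e) = directImage-preimage (onV f) a ; (q , e′) = directImage-preimage (onD f) b in
    (p , q) , cong₂ _,_ e e′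

  im-cong : ∀ {ψ G : BGraph B} (f g : ψ ↪ G) → (∀ v → onV f v ≡ onV g v) → (∀ e → onD f e ≡ onD g e) → im f ≡ im g
  im-cong f g eV eD = cong₂ _,_ (range-cong eV) (range-cong eD)

  iso-sizes : ∀ (ψ φ : BGraph B) → BIso ψ φ → nV (gr ψ) ≡ nV (gr φ) × nD (gr ψ) ≡ nD (gr φ)
  iso-sizes ψ φ i = ℕP.≤-antisym (size (onV to) (injV to)) (size (onV from) (injV from)) ,
                    ℕP.≤-antisym (size (onD to) (injD to)) (size (onD from) (injD from))
    where
    to : ψ ↪ φ
    to = iso⇒↪ ψ φ i
    from : φ ↪ ψ
    from = iso⇒↪ φ ψ (BIso-sym ψ φ i)
    size : ∀ {a b} (f : Fin a → Fin b) → Inj f → a ℕ.≤ b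
    size f inj = FinP.injective⇒≤ {f = f} (λ {x} {y} → inj x y)

-- Subgraphs lying in Ψ⁺ and the full union

module _ {B : Graph} {m : ℕ} (Ψ : Fin m → BGraph B) where

  -- M is the mask of a subgraph of G lying in Ψ⁺.
  record PlusMask (G : BGraph B) (M : Mask (nV (gr G)) (nD (gr G))) : Set where
    field
      some : ∃[ i ] Σ (Ψ i ↪ G) λ f → im f ⊑ M
      covV : ∀ {v} → v ∈ₛ proj₁ M → ∃[ i ] Σ (Ψ i ↪ G) λ f → im f ⊑ M × ∃[ x ] onV f x ≡ v
      covD : ∀ {e} → e ∈ₛ proj₂ M → ∃[ i ] Σ (Ψ i ↪ G) λ f → im f ⊑ M × ∃[ x ] onD f x ≡ e
  open PlusMask

  module _ {G : BGraph B} where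

    inUnionV⁺ : ∀ {i} (f : Ψ i ↪ G) x → InUnionV Ψ G (onV f x)
    inUnionV⁺ {i} f x = let (g , g∈ , eV , _) = ∈-embeddings f in i , lose g∈ (x , eV x)

    inUnionD⁺ : ∀ {i} (f : Ψ i ↪ G) x → InUnionD Ψ G (onD f x)
    inUnionD⁺ {i} f x = let (g , g∈ , _ , eD) = ∈-embeddings f in i , lose g∈ (x , eD x)

    inUnionV⁻ : ∀ {v} → InUnionV Ψ G v → ∃[ i ] Σ (Ψ i ↪ G) λ f → ∃[ x ] onV f x ≡ v
    inUnionV⁻ (i , any) = let (g , g∈ , x , e) = find any in i , embedding-of {ψ = Ψ i} {G} g∈ , x , e

    inUnionD⁻ : ∀ {e} → InUnionD Ψ G e → ∃[ i ] Σ (Ψ i ↪ G) λ f → ∃[ x ] onD f x ≡ e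
    inUnionD⁻ (i , any) = let (g , g∈ , x , e) = find any in i , embedding-of {ψ = Ψ i} {G} g∈ , x , e

  module _ {G : BGraph B} where

    plus-closed : ∀ {M} → PlusMask G M → Closed (gr G) M
    plus-closed P e∈ = let (i , f , f⊑ , x , eq) = covD P e∈ ; (a , b) = im-closed f (∈-range (onD f) (x , eq)) in
      proj₂ f⊑ a , proj₁ f⊑ b

    plus-im : ∀ {i} (f : Ψ i ↪ G) → PlusMask G (im f)
    plus-im f = record
      { some = _ , f , ⊑-refl
      ; covV = λ v∈ → _ , f , ⊑-refl , ∈-range⁻ (onV f) v∈
      ; covD = λ e∈ → _ , f , ⊑-refl , ∈-range⁻ (onD f) e∈ }

    plus-⊔ : ∀ {M N} → PlusMask G M → PlusMask G N → PlusMask G (M ⊔ N)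
    plus-⊔ {M} {N} P Q = record
      { some = let (i , f , s) = some P in i , f , ⊑-trans s (⊑-⊔ˡ M N)
      ; covV = λ v∈ → [ (λ a → let (i , f , s , x) = covV P a in i , f , ⊑-trans s (⊑-⊔ˡ M N) , x)
                      , (λ a → let (i , f , s , x) = covV Q a in i , f , ⊑-trans s (⊑-⊔ʳ M N) , x) ]′ (x∈p∪q⁻ (proj₁ M) (proj₁ N) v∈)
      ; covD = λ e∈ → [ (λ a → let (i , f , s , x) = covD P a in i , f , ⊑-trans s (⊑-⊔ˡ M N) , x)
                      , (λ a → let (i , f , s , x) = covD Q a in i , f , ⊑-trans s (⊑-⊔ʳ M N) , x) ]′ (x∈p∪q⁻ (proj₂ M) (proj₂ N) e∈) }

    -- A copy of ψ^i in G that lies inside `im f` factors through `f`, so the cover seen in G is a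
    -- cover of ψ itself.
    plus⇒InPlus : ∀ {ψ} (f : ψ ↪ G) → PlusMask G (im f) → InPlus Ψ ψ
    plus⇒InPlus {ψ} f P =
      (let (i , g , s) = some P ; (h , _) = factor f g s in i , emb h , isEmb h) ,
      (λ v → let (i , g , s , x , e) = covV P (∈-range⁺ (onV f) v) ; (h , fhV , _) = factor f g s in
        subst (InUnionV Ψ ψ) (injV f _ _ (trans (fhV x) e)) (inUnionV⁺ h x)) ,
      (λ d → let (i , g , s , x , e) = covD P (∈-range⁺ (onD f) d) ; (h , _ , fhD) = factor f g s in
        subst (InUnionD Ψ ψ) (injD f _ _ (trans (fhD x) e)) (inUnionD⁺ h x))

  InPlus⇒plus : ∀ {ψ G} (f : ψ ↪ G) → InPlus Ψ ψ → PlusMask G (im f)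
  InPlus⇒plus f ((i , g , g-emb) , allV , allD) = record
    { some = i , f ∘↪ mk↪ {ψ = Ψ i} g g-emb , im-∘-⊑ f (mk↪ {ψ = Ψ i} g g-emb)
    ; covV = λ v∈ → let (x , e) = ∈-range⁻ (onV f) v∈ ; (j , h , y , e′) = inUnionV⁻ (allV x) in
        j , f ∘↪ h , im-∘-⊑ f h , y , trans (cong (onV f) e′) e
    ; covD = λ e∈ → let (x , e) = ∈-range⁻ (onD f) e∈ ; (j , h , y , e′) = inUnionD⁻ (allD x) in
        j , f ∘↪ h , im-∘-⊑ f h , y , trans (cong (onD f) e′) e }

  totalD : ℕ
  totalD = sum (map (λ i → nD (gr (Ψ i))) (allFin m))

  module _ (G : BGraph B) where

    unionMask : Mask (nV (gr G)) (nD (gr G))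
    unionMask = setOf (inUnionV? Ψ G) , setOf (inUnionD? Ψ G)

    ordOf-union : ordOf (gr G) unionMask ≡ ordΨ Ψ G
    ordOf-union = cong₂ (λ a b → + a ℤ.- + b)
      (count-cong (edgeRep? (gr G) (proj₂ unionMask)) (λ e → inUnionD? Ψ G e ×-dec (e FinP.≤? inv (gr G) e))
        (λ (a , b) → ∈-setOf⁻ (inUnionD? Ψ G) a , b) (λ (a , b) → ∈-setOf⁺ (inUnionD? Ψ G) a , b))
      (count-cong (_∈? proj₁ unionMask) (inUnionV? Ψ G) (∈-setOf⁻ (inUnionV? Ψ G)) (∈-setOf⁺ (inUnionV? Ψ G)))

    im⊑union : ∀ {i} (f : Ψ i ↪ G) → im f ⊑ unionMask
    im⊑union f =
      (λ v∈ → let (x , e) = ∈-range⁻ (onV f) v∈ in ∈-setOf⁺ (inUnionV? Ψ G) (subst (InUnionV Ψ G) e (inUnionV⁺ f x))) ,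
      (λ v∈ → let (x , e) = ∈-range⁻ (onD f) v∈ in ∈-setOf⁺ (inUnionD? Ψ G) (subst (InUnionD Ψ G) e (inUnionD⁺ f x)))

    plus⊑union : ∀ {M} → PlusMask G M → M ⊑ unionMask
    plus⊑union P =
      (λ v∈ → let (i , f , _ , x , e) = covV P v∈ in proj₁ (im⊑union f) (∈-range (onV f) (x , e))) ,
      (λ v∈ → let (i , f , _ , x , e) = covD P v∈ in proj₂ (im⊑union f) (∈-range (onD f) (x , e)))

    union-closed : Closed (gr G) unionMask
    union-closed e∈ =
      let (i , f , x , eq) = inUnionD⁻ (∈-setOf⁻ (inUnionD? Ψ G) e∈)
          (a , b) = im-closed f (∈-range (onD f) (x , eq)) in
      proj₂ (im⊑union f) a , proj₁ (im⊑union f) b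

    -- The vertex lies in a copy of a pruned ψ^i, whose edges at that vertex are carried injectively
    -- into the union.
    union-degree : (∀ i → Pruned (gr (Ψ i))) → ∀ {v} → v ∈ₛ proj₁ unionMask →
      2 ℕ.≤ count (edgesAt? (gr G) (proj₂ unionMask) v)
    union-degree pruned {v} v∈ = let (i , f , x , eq) = inUnionV⁻ (∈-setOf⁻ (inUnionV? Ψ G) v∈) in
      ℕP.≤-trans (pruned i x) (count-inj (λ e → tl (gr (Ψ i)) e Fin.≟ x) (edgesAt? (gr G) (proj₂ unionMask) v) (onD f)
        (λ _ _ → injD f _ _)
        λ {e} tl≡ → proj₂ (im⊑union f) (∈-range⁺ (onD f) e) , trans (comm-tl f e) (trans (cong (onV f) tl≡) eq))

    ordOf-plus≤ordΨ : (∀ i → Pruned (gr (Ψ i))) → ∀ {M} → PlusMask G M → ordOf (gr G) M ℤ.≤ ordΨ Ψ G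
    ordOf-plus≤ordΨ pruned {M} P = subst (ordOf (gr G) M ℤ.≤_) ordOf-union
      (ordOf-mono (gr G) (plus-closed P) union-closed (plus⊑union P) (union-degree pruned))

    ΨCopies : List (Mask (nV (gr G)) (nD (gr G)))
    ΨCopies = concatMap (λ i → copies (Ψ i) G) (allFin m)

    ∈-ΨCopies⁺ : ∀ {i} (f : Ψ i ↪ G) → im f ∈ ΨCopies
    ∈-ΨCopies⁺ {i} f = ∈-concatMap⁺ (λ i → copies (Ψ i) G) (lose (∈-allFin i) (∈-copies⁺ f))

    ∈-ΨCopies⁻ : ∀ {M} → M ∈ ΨCopies → ∃[ i ] Σ (Ψ i ↪ G) λ f → im f ≡ M
    ∈-ΨCopies⁻ M∈ with i , _ , M∈i ← find (∈-concatMap⁻ (λ i → copies (Ψ i) G) {xs = allFin m} M∈) =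
      i , ∈-copies⁻ (Ψ i) G M∈i

    joins-ΨCopies : ∀ {M} → PlusMask G M → joins M ΨCopies ≡ unionMask
    joins-ΨCopies P = ⊑-antisym
      (joins-⊑ ΨCopies (plus⊑union P) (λ x∈ → let (i , f , e) = ∈-ΨCopies⁻ x∈ in subst (_⊑ unionMask) e (im⊑union f)))
      ((λ v∈ → let (i , f , x , e) = inUnionV⁻ (∈-setOf⁻ (inUnionV? Ψ G) v∈) in
          proj₁ (∈-joins (∈-ΨCopies⁺ f)) (∈-range (onV f) (x , e))) ,
       (λ v∈ → let (i , f , x , e) = inUnionD⁻ (∈-setOf⁻ (inUnionD? Ψ G) v∈) in
          proj₂ (∈-joins (∈-ΨCopies⁺ f)) (∈-range (onD f) (x , e))))

    -- The order grows by at most totalD per step, so it cannot jump over the window [r, r + totalD).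
    crossing : ∀ r {M} xs → (∀ {x} → x ∈ xs → ∃[ i ] Σ (Ψ i ↪ G) λ f → im f ≡ x) →
      PlusMask G M → ordOf (gr G) M ℤ.< + r → + r ℤ.≤ ordOf (gr G) (joins M xs) →
      ∃[ H ] PlusMask G H × M ⊑ H × + r ℤ.≤ ordOf (gr G) H × ordOf (gr G) H ℤ.< + (r + totalD)
    crossing r [] _ P lt ge = contradiction lt (ℤP.≤⇒≯ ge)
    crossing r {M} (x ∷ xs) cs P lt ge with i , f , refl ← cs (here refl) | ordOf (gr G) (M ⊔ x) ℤP.<? + r
    ... | yes lt′ = let (H , PH , s , a , b) = crossing r xs (cs ∘ there) (plus-⊔ P (plus-im f)) lt′ ge in
                    H , PH , ⊑-trans (⊑-⊔ˡ M x) s , a , b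
    ... | no ge′  = M ⊔ x , plus-⊔ P (plus-im f) , ⊑-⊔ˡ M x , ℤP.≮⇒≥ ge′ ,
      -- The order of `M` is still below `r`, and the added copy has at most `nD (gr (Ψ i))`
      -- oriented edges, one summand of `totalD`.
      ℤP.≤-<-trans (ordOf-⊔ (gr G) M x) (ℤP.+-mono-<-≤ lt (ℤ.+≤+
        (ℕP.≤-trans (count-range-≤ (onD f)) (∈-sum (λ i → nD (gr (Ψ i))) (∈-allFin i)))))

-- The function μ

module _ {B : Graph} {m : ℕ} (Ψ : Fin m → BGraph B) where

  nonempty? : ∀ i → Dec (0 ℕ.< nV (gr (Ψ i)))
  nonempty? i = 0 ℕP.<? nV (gr (Ψ i))

  abstract
    -- An empty ψ^i embeds in every G without witnessing `Meets`, hence the filter. Outside the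
    -- abstract block only the two membership laws are available.
    pieces : (G : BGraph B) → List (Mask (nV (gr G)) (nD (gr G)))
    pieces G = concatMap (λ i → copies (Ψ i) G) (filter nonempty? (allFin m))

    ∈-pieces⁺ : ∀ {i} {G : BGraph B} → 0 ℕ.< nV (gr (Ψ i)) → (f : Ψ i ↪ G) → im f ∈ pieces G
    ∈-pieces⁺ {i} {G} pos f = ∈-concatMap⁺ (λ i → copies (Ψ i) G) (lose (∈-filter⁺ nonempty? (∈-allFin i) pos) (∈-copies⁺ f))

    ∈-pieces⁻ : ∀ (G : BGraph B) {M} → M ∈ pieces G → ∃[ i ] 0 ℕ.< nV (gr (Ψ i)) × Σ (Ψ i ↪ G) λ f → im f ≡ M
    ∈-pieces⁻ G M∈ with i , i∈ , M∈i ← find (∈-concatMap⁻ (λ i → copies (Ψ i) G) {xs = filter nonempty? (allFin m)} M∈) =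
      i , proj₂ (∈-filter⁻ nonempty? {xs = allFin m} i∈) , ∈-copies⁻ (Ψ i) G M∈i

  weight : (G : BGraph B) → Mask (nV (gr G)) (nD (gr G)) → ℚ
  weight G = Covers.cov⁺ (pieces G) (none G)

  μ : BGraph B → ℚ
  μ ψ = weight ψ (whole ψ)

  -- By `factor` the pieces of G below `im f` are the pushed pieces of ψ; `cov⁺-set` discards the
  -- others, and the signed sum is carried along `push f`, an injective map that preserves joins.
  weight-push : ∀ {ψ G : BGraph B} (f : ψ ↪ G) → weight G (im f) ≡ μ ψ
  weight-push {ψ} {G} f = begin
    weight G (im f)
      ≡⟨ CoverLaws.cov⁺-set {nV (gr G)} {nD (gr G)} {xs = pieces G} {a = none G} {M = im f} to from ⟩
    Covers.cov⁺ (map (push f) (pieces ψ)) (none G) (im f)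
      ≡⟨ cong₂ (Covers.cov⁺ {nV (gr G)} {nD (gr G)} (map (push f) (pieces ψ))) (sym (push-none f)) (sym (push-whole f)) ⟩
    Covers.cov⁺ (map (push f) (pieces ψ)) (push f (none ψ)) (push f (whole ψ))
      ≡⟨ cov⁺-map {_∪_ = _⊔_} {_≟_ = _≟ₘ_} {_∪′_ = _⊔_} {_≟′_ = _≟ₘ_} {h = push f}
                (push-inj f) (push-⊔ f) (pieces ψ) (none ψ) (whole ψ) ⟩
    μ ψ                                                                          ∎
    where
    open ≡-Reasoning
    to : ∀ {M} → M ∈ pieces G → M Covers.≼ im f → M ∈ map (push f) (pieces ψ)
    to M∈ M≼ with i , pos , g , refl ← ∈-pieces⁻ G M∈ =
      let (h , fhV , fhD) = factor f g (≼⇒⊑ {M = im g} {N = im f} M≼) in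
      subst (_∈ map (push f) (pieces ψ)) (trans (push-im f h) (im-cong (f ∘↪ h) g fhV fhD)) (∈-map⁺ (push f) (∈-pieces⁺ pos h))
    from : ∀ {M} → M ∈ map (push f) (pieces ψ) → M Covers.≼ im f → M ∈ pieces G
    from M∈ _ with N , N∈ , refl ← ∈-map⁻ (push f) M∈ with i , pos , h , refl ← ∈-pieces⁻ ψ N∈ =
      subst (_∈ pieces G) (sym (push-im f h)) (∈-pieces⁺ pos (f ∘↪ h))

  -- The isomorphism and the identity have the same image in φ; its weight is `μ ψ` by the one and
  -- `μ φ` by the other.
  μ-iso : ∀ ψ φ → BIso ψ φ → μ ψ ≡ μ φ
  μ-iso ψ φ i = begin
    μ ψ                            ≡⟨ sym (weight-push (iso⇒↪ ψ φ i)) ⟩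
    weight φ (im (iso⇒↪ ψ φ i))    ≡⟨ cong (weight φ) (im-iso ψ φ i) ⟩
    weight φ (im (id↪ φ))          ≡⟨ weight-push (id↪ φ) ⟩
    μ φ                            ∎
    where open ≡-Reasoning

  Isum≡sum-weight : ∀ L G → Isum μ L G ≡ sumℚ (weight G) (allSubcopies L G)
  Isum≡sum-weight L G = sym (trans (sumℚ-concatMap (weight G) (λ ψ → subcopies ψ G) L) (sumℚ-cong L λ {ψ} _ → trans
    (sumℚ-cong (subcopies ψ G) λ M∈ → let (f , e) = ∈-subcopies⁻ ψ G M∈ in trans (cong (weight G) (sym e)) (weight-push f))
    (sumℚ-const (μ ψ) (subcopies ψ G))))

  -- `none G` occurs among the unions because of the empty family, which `cov⁺` leaves out. Every
  -- piece has a vertex, so no nonempty family has this union.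
  weight-none : ∀ G → weight G (none G) ≡ 0ℚ
  weight-none G = CoverLaws.cov⁺-start {nV (gr G)} {nD (gr G)} (pieces G) {a = none G} λ {M} M∈ M≼ →
    let (i , pos , f , e) = ∈-pieces⁻ G M∈
        x = Fin.fromℕ< pos
    in ∉⊥ (proj₁ (≼⇒⊑ {M = M} {N = none G} M≼) (subst (λ N → onV f x ∈ₛ proj₁ N) e (∈-range⁺ (onV f) x)))

  -- Sums over systems of representatives

  #masks : BGraph B → ℕ
  #masks ψ = length (masks (nV (gr ψ)) (nD (gr ψ)))

  module _ {r : ℕ} {L : List (BGraph B)} (reps : Reps Ψ r L) where

    -- The mask is made into an abstract graph, replaced by its representative, and embedded again
    -- with the same image.
    plus∈reps : ∀ {G M} → PlusMask Ψ G M → ordOf (gr G) M ℤ.< + r →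
      ∃[ φ ] φ ∈ L × Σ (φ ↪ G) λ f → im f ≡ M
    plus∈reps {G} P lt with ψ , f , refl ← subgraph {G = G} (plus-closed Ψ P) =
      let (φ , φ∈ , i) = proj₁ (proj₂ reps) ψ (plus⇒InPlus Ψ f P) (subst (ℤ._< + r) (sym (ordOf-im f)) lt)
          (g , e) = transport↪ i f
      in φ , φ∈ , g , e

    Isum-below : (∀ i → Pruned (gr (Ψ i))) → ∀ G → ordΨ Ψ G ℤ.< + r →
      Isum μ L G ≡ 1ℚ ℚ.- Covers.emptyIndicator (pieces G)
    Isum-below pruned G lt = begin
      Isum μ L G                                        ≡⟨ Isum≡sum-weight L G ⟩
      sumℚ (weight G) (allSubcopies L G)                ≡⟨ sumℚ-extend _≟ₘ_ (weight G)
                                                             (allSubcopies-unique G (proj₂ (proj₂ reps))) unique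
                                                             (∈-deduplicate⁺ _≟ₘ_ ∘ ∈-++⁺ˡ) vanish ⟩
      sumℚ (weight G) Ms                                ≡⟨ CoverLaws.sum-cov⁺ {nV (gr G)} {nD (gr G)} (pieces G) {a = none G} unique union∈ ⟩
      1ℚ ℚ.- Covers.emptyIndicator (pieces G)           ∎
      where
      open ≡-Reasoning
      -- `Ms` contains the subgraphs over which I_r sums and also all unions of families of pieces,
      -- so the truncated sum extends to it and inclusion-exclusion applies on it.
      Us Ms : List (Mask (nV (gr G)) (nD (gr G)))
      Us = Covers.unions (pieces G) (none G)
      Ms = deduplicate _≟ₘ_ (allSubcopies L G ++ Us)
      unique : Unique Ms
      unique = deduplicate-! _≟ₘ_ (allSubcopies L G ++ Us)
      union∈ : ∀ {M} → M ∈ Us → M ∈ Ms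
      union∈ = ∈-deduplicate⁺ _≟ₘ_ ∘ ∈-++⁺ʳ (allSubcopies L G)
      union-plus : ∀ {M} → M ∈ Us → M ≡ none G ⊎ PlusMask Ψ G M
      union-plus = Covers.unions-ind {Q = λ M → M ≡ none G ⊎ PlusMask Ψ G M} (pieces G) (inj₁ refl) λ {M} {x} x∈ →
        let (i , _ , f , e) = ∈-pieces⁻ G x∈ ; Px = subst (PlusMask Ψ G) e (plus-im Ψ f)
        in [ (λ M≡ → inj₂ (subst (PlusMask Ψ G) (sym (trans (cong (_⊔ x) M≡) (none-⊔ {G = G} x))) Px)) ,
             (λ P → inj₂ (plus-⊔ Ψ P Px)) ]′
      -- A mask of `Ms` outside the truncated sum is a union of pieces: it is `none G`, or it is in
      -- Ψ⁺ with order at most `ordΨ Ψ G`, hence below `r`, and then it was listed after all.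
      vanish : ∀ {M} → M ∈ Ms → M ∉ allSubcopies L G → weight G M ≡ 0ℚ
      vanish {M} M∈ M∉ =
        [ (λ a → contradiction a M∉) , [ (λ e → trans (cong (weight G) e) (weight-none G)) , absurd ]′ ∘ union-plus ]′
        (∈-++⁻ (allSubcopies L G) (∈-deduplicate⁻ _≟ₘ_ (allSubcopies L G ++ Us) M∈))
        where
        absurd : PlusMask Ψ G M → weight G M ≡ 0ℚ
        absurd P = let (φ , φ∈ , f , e) = plus∈reps P (ℤP.≤-<-trans (ordOf-plus≤ordΨ Ψ G pruned P) lt)
          in contradiction (subst (_∈ allSubcopies L G) e (∈-allSubcopies⁺ φ∈ f)) M∉

    Isum-meets : (∀ i → Pruned (gr (Ψ i))) → ∀ G → ordΨ Ψ G ℤ.< + r → Meets Ψ G → Isum μ L G ≡ 1ℚ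
    Isum-meets pruned G lt (i , pos , f , f-emb) = trans (Isum-below pruned G lt)
      (cong (λ c → 1ℚ ℚ.- c) (indicator (∈-pieces⁺ pos (mk↪ f f-emb))))
      where
      indicator : ∀ {M : Mask (nV (gr G)) (nD (gr G))} {xs} → M ∈ xs → Covers.emptyIndicator xs ≡ 0ℚ
      indicator (here _)  = refl
      indicator (there _) = refl

    Isum-avoids : (∀ i → Pruned (gr (Ψ i))) → ∀ G → ordΨ Ψ G ℤ.< + r → ¬ Meets Ψ G → Isum μ L G ≡ 0ℚ
    Isum-avoids pruned G lt ¬meets = trans (Isum-below pruned G lt)
      (cong (λ c → 1ℚ ℚ.- c) (indicator λ M∈ → let (i , pos , f , _) = ∈-pieces⁻ G M∈ in ¬meets (i , pos , emb f , isEmb f)))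
      where
      indicator : ∀ {xs : List (Mask (nV (gr G)) (nD (gr G)))} → (∀ {M} → M ∉ xs) → Covers.emptyIndicator xs ≡ 1ℚ
      indicator {[]}     _ = refl
      indicator {x ∷ xs} h = contradiction (here refl) h

    -- Each `ψ` in `L` has an isomorphic partner in `L₀`; the sum of all absolute values over `L₀`
    -- stands in for their maximum.
    μ-bound : ∀ L₀ → Reps Ψ r L₀ → ∀ {ψ} → ψ ∈ L → ℚ.∣ μ ψ ∣ ℚ.≤ sumℚ (λ φ → ℚ.∣ μ φ ∣) L₀
    μ-bound L₀ reps₀ {ψ} ψ∈ =
      let (inPlus , lt) = proj₁ reps ψ∈
          (φ , φ∈ , i)  = proj₁ (proj₂ reps₀) ψ inPlus lt
      in subst (λ c → ℚ.∣ c ∣ ℚ.≤ _) (sym (μ-iso ψ φ i)) (∈-sumℚ (λ φ → ℚP.0≤∣p∣ (μ φ)) φ∈)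

    #masks-bound : ∀ L₀ → Reps Ψ r L₀ → ∀ {ψ} → ψ ∈ L → #masks ψ ℕ.≤ sum (map #masks L₀)
    #masks-bound L₀ reps₀ {ψ} ψ∈ =
      let (inPlus , lt) = proj₁ reps ψ∈
          (φ , φ∈ , i)  = proj₁ (proj₂ reps₀) ψ inPlus lt
          (eV , eD)     = iso-sizes ψ φ i
      in subst (ℕ._≤ _) (sym (cong₂ (λ n d → length (masks n d)) eV eD)) (∈-sum #masks φ∈)

  -- Every copy of order < r extends to one in the window, and a window copy contains boundedly many masks.
  count-below≤tail : ∀ {r L L′ L₀} → Reps Ψ r L → Reps Ψ (r + totalD Ψ) L′ → Reps Ψ (r + totalD Ψ) L₀ →
    ∀ G → + r ℤ.≤ ordΨ Ψ G →
    sum (map (λ ψ → #sub ψ G) L) ℕ.≤ sum (map #masks L₀) ℕ.* tailSum r L′ G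
  count-below≤tail {r} {L} {L′} {L₀} reps reps′ reps₀ G ge =
    let (zs , len , cov) = length-cover {R = λ M H → M ⊑ H} (allSubcopies T G) fibre in begin
    sum (map (λ ψ → #sub ψ G) L)                            ≡⟨ sym (length-concatMap (λ ψ → subcopies ψ G) L) ⟩
    length (allSubcopies L G)                               ≤⟨ length-⊆ (allSubcopies-unique G (proj₂ (proj₂ reps)))
                                                                 (λ M∈ → let (H , H∈ , M⊑H) = extend M∈ in cov H∈ M⊑H) ⟩
    length zs                                               ≤⟨ len ⟩
    sum (map #masks L₀) ℕ.* length (allSubcopies T G)       ≡⟨ cong (sum (map #masks L₀) ℕ.*_) (length-concatMap (λ ψ → subcopies ψ G) T) ⟩
    sum (map #masks L₀) ℕ.* tailSum r L′ G                  ∎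
    where
    open ℕP.≤-Reasoning
    r≤ord? : ∀ (ψ : BGraph B) → Dec (+ r ℤ.≤ ord (gr ψ))
    r≤ord? ψ = + r ℤ.≤? ord (gr ψ)
    T : List (BGraph B)
    -- Representatives of the window; the filter is the one in `tailSum`.
    T = filter r≤ord? L′
    -- Masks inside a copy of `φ` are pushed from masks of `φ`, so their number is bounded
    -- independently of G. All masks are counted, whether closed or not.
    fibre : ∀ {H} → H ∈ allSubcopies T G → ∃[ zs ] length zs ℕ.≤ sum (map #masks L₀) × (∀ {M} → M ⊑ H → M ∈ zs)
    fibre H∈ =
      let (φ , φ∈ , f , e) = ∈-allSubcopies⁻ T G H∈
          ms = masks (nV (gr φ)) (nD (gr φ))
      in map (push f) ms ,
         ℕP.≤-trans (ℕP.≤-reflexive (ListP.length-map (push f) ms))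
           (#masks-bound reps′ L₀ reps₀ (proj₁ (∈-filter⁻ r≤ord? {xs = L′} φ∈))) ,
         λ {M} M⊑ → let (N , e′) = push-preimage f {M} (subst (M ⊑_) (sym e) M⊑) in
           subst (_∈ map (push f) ms) e′ (∈-map⁺ (push f) (∈-masks N))
    -- Joining all copies of the ψ^i to `M` ends at the full union, of order at least `r`, so
    -- `crossing` finds an `H` in the window on the way.
    extend : ∀ {M} → M ∈ allSubcopies L G → ∃[ H ] H ∈ allSubcopies T G × M ⊑ H
    extend {M} M∈ =
      let (ψ , ψ∈ , f , e) = ∈-allSubcopies⁻ L G M∈
          (inPlus , lt) = proj₁ reps ψ∈
          P = subst (PlusMask Ψ G) e (InPlus⇒plus Ψ f inPlus)
          (H , PH , M⊑H , r≤ , <r+) = crossing Ψ G r (ΨCopies Ψ G) (∈-ΨCopies⁻ Ψ G) P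
            (subst (ℤ._< + r) (trans (ordOf-im f) (cong (ordOf (gr G)) e)) lt)
            (subst (+ r ℤ.≤_) (sym (trans (cong (ordOf (gr G)) (joins-ΨCopies Ψ G P)) (ordOf-union Ψ G))) ge)
          (φ , φ∈ , g , e′) = plus∈reps reps′ PH <r+
          r≤ordφ = subst (+ r ℤ.≤_) (sym (trans (ordOf-im g) (cong (ordOf (gr G)) e′))) r≤
      in H , subst (_∈ allSubcopies T G) e′ (∈-allSubcopies⁺ (∈-filter⁺ r≤ord? φ∈ r≤ordφ) g) , M⊑H

  -- The first factor bounds `μ` on Ψ⁺ below order `r`, the second the number of subgraphs contained
  -- in one window copy.
  bound-constant : List (BGraph B) → List (BGraph B) → ℚ
  bound-constant L₀ L₁ = sumℚ (λ φ → ℚ.∣ μ φ ∣) L₀ ℚ.* ℕtoℚ (sum (map #masks L₁))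

  Isum-above : ∀ {r L L′ L₀ L₁} → Reps Ψ r L → Reps Ψ (r + totalD Ψ) L′ → Reps Ψ r L₀ → Reps Ψ (r + totalD Ψ) L₁ →
    ∀ G → + r ℤ.≤ ordΨ Ψ G → ℚ.∣ Isum μ L G ∣ ℚ.≤ bound-constant L₀ L₁ ℚ.* ℕtoℚ (tailSum r L′ G)
  Isum-above {r} {L} {L′} {L₀} {L₁} reps reps′ reps₀ reps₁ G ge =
    scale-bound (sumℚ (λ φ → ℚ.∣ μ φ ∣) L₀) (sum (map #masks L₁)) (sum (map (λ ψ → #sub ψ G) L)) (tailSum r L′ G)
      (sumℚ-nonneg L₀ λ φ → ℚP.0≤∣p∣ (μ φ))
      (∣sumℚ∣-bound (λ ψ → #sub ψ G) μ (sumℚ (λ φ → ℚ.∣ μ φ ∣) L₀) L (μ-bound reps L₀ reps₀))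
      (count-below≤tail reps reps′ reps₁ G ge)

theorem8p6 : (B : Graph) (m : ℕ) (Ψ : Fin m → BGraph B) →
    (∀ s → Σ (List (BGraph B)) (Reps Ψ s)) →
    (∀ i → Pruned (gr (Ψ i))) →
    Σ (BGraph B → ℚ) λ μ →
    (∀ ψ φ → BIso ψ φ → μ ψ ≡ μ φ) ×
    (∀ (r : ℕ) → Σ ℚ λ C → Σ ℕ λ s →
    ∀ (L : List (BGraph B)) → Reps Ψ r L →
    (∀ (G : BGraph B) → ordΨ Ψ G <ℤ + r →
    (Meets Ψ G → Isum μ L G ≡ 1ℚ) × (¬ Meets Ψ G → Isum μ L G ≡ 0ℚ)) ×
    (∀ (L′ : List (BGraph B)) → Reps Ψ (r + s) L′ →
    ∀ (G : BGraph B) → + r ≤ℤ ordΨ Ψ G →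
    ∣ Isum μ L G ∣ ≤ C * ℕtoℚ (tailSum r L′ G)))
theorem8p6 B m Ψ finite pruned = μ Ψ , μ-iso Ψ , λ r →
  -- These lists fix the constant before `L` and `L′` are given.
  let (L₀ , reps₀) = finite r
      (L₁ , reps₁) = finite (r + totalD Ψ)
  in bound-constant Ψ L₀ L₁ , totalD Ψ , λ L reps →
    (λ G lt → Isum-meets Ψ reps pruned G lt , Isum-avoids Ψ reps pruned G lt) ,
    λ L′ reps′ G ge → Isum-above Ψ reps reps′ reps₀ reps₁ G ge
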